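{- Let $n\ge 0$ be an integer and let $\mathbf E=[E_0,E_1,\ldots,E_n]$ be a family of polynomials $E_j(t)\in\mathbb{C}[t]$ such that $E_j$ has degree at most $j$ for each $j$. Write $E_j(t)=\frac{t^j}{j!}v_j+(\text{terms of degree}<j)$ with $v_j\in\mathbb{C}$, and put $$c(\mathbf E)=\sum_{p=0}^n(-1)^{n-p}(p+1)v_p .$$ For $0\le p\le n$ define $F_p(t)=\sum_{j=0}^p(-1)^j\binom{n-j}{n-p}E_j(t)$. If $n$ is odd and $m=(n+1)/2$, then $$c(\mathbf E)=\sum_{p=m}^n\sum_{i=1}^{p+1-m}(-1)^{p+m-i}\binom{p+1}{m+i}\, i\,\big(E_p(-i)+F_p(i)\big).$$ If $n$ is even and $m=n/2$, then $$c(\mathbf E)=\sum_{p=m}^n\sum_{i=1}^{p+1-m}(-1)^{p+1+m-i}\left(\binom{p+1}{m+i}-\binom{p+1}{m+i+1}\right)\frac{i}{2}\,\big(E_p(-i)+F_p(i)\big).$$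
   Context: $\binom{a}{b}=0$ when $b>a\ge 0$. -}

module Defs where

open import Algebra.Bundles using (CommutativeRing)
open import Data.Fin.Base using (toℕ)
open import Data.Integer.Base using (+_)
open import Data.List.Base using (List; []; _∷_)
open import Data.Nat.Base as ℕ using (ℕ; zero; suc; _∸_; _!)
open import Data.Nat.Combinatorics using (_C_)
import Data.Nat.Properties as ℕ
open import Data.Product.Base using (_×_; _,_; ∃-syntax)
open import Data.Rational.Base as ℚ using (ℚ; Positive)
import Data.Rational.Properties as ℚ
open import Function.Base using (case_of_)
open import Level using (0ℓ)
open import Relation.Binary.Structures using (IsEquivalence)

module RingIdentities {r ℓ} (R : CommutativeRing r ℓ) where

  open CommutativeRing R
  open import Algebra.Properties.Group +-group using (⁻¹-anti-homo-//; //-rightDividesˡ)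
  open import Algebra.Properties.Ring ring
    using (x[y-z]≈xy-xz; [y-z]x≈yx-zx; -0#≈0#; -1*x≈-x; -‿+-comm)
  open import Algebra.Solver.Ring.NaturalCoefficients.Default commutativeSemiring
    using (solve; _:=_; _:+_; _:*_)

  -- The solver knows no negation: subtraction is turned into addition of a
  -- multiple of σ, which the solver then treats as a variable.
  private
    σ : Carrier
    σ = - 1#

    sub : ∀ a b → a - b ≈ a + σ * b
    sub a b = +-congˡ (sym (-1*x≈-x b))

  +-sub-+ : ∀ a b c d → (a + b) - (c + d) ≈ (a - c) + (b - d)
  +-sub-+ a b c d = trans (sub (a + b) (c + d)) (trans
    (solve 5 (λ s a b c d →
      (a :+ b) :+ s :* (c :+ d) := (a :+ s :* c) :+ (b :+ s :* d)) refl σ a b c d)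
    (sym (+-cong (sub a c) (sub b d))))

  neg-sub-neg : ∀ a b → - (a - b) ≈ (- a) - (- b)
  neg-sub-neg a b = sym (-‿+-comm a (- b))

  *-assoc-re : ∀ a b c d e f →
    (a * c - b * d) * e - (a * d + b * c) * f ≈ a * (c * e - d * f) - b * (c * f + d * e)
  *-assoc-re a b c d e f = trans
    (trans (+-congʳ (*-congʳ (sub (a * c) (b * d)))) (sub _ _)) (trans
    (solve 7 (λ s a b c d e f →
      (a :* c :+ s :* (b :* d)) :* e :+ s :* ((a :* d :+ b :* c) :* f) :=
      a :* (c :* e :+ s :* (d :* f)) :+ s :* (b :* (c :* f :+ d :* e))) refl σ a b c d e f)
    (sym (trans (+-congʳ (*-congˡ (sub (c * e) (d * f)))) (sub _ _))))

  *-assoc-im : ∀ a b c d e f →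
    (a * c - b * d) * f + (a * d + b * c) * e ≈ a * (c * f + d * e) + b * (c * e - d * f)
  *-assoc-im a b c d e f = trans
    (+-congʳ (*-congʳ (sub (a * c) (b * d)))) (trans
    (solve 7 (λ s a b c d e f →
      (a :* c :+ s :* (b :* d)) :* f :+ (a :* d :+ b :* c) :* e :=
      a :* (c :* f :+ d :* e) :+ b :* (c :* e :+ s :* (d :* f))) refl σ a b c d e f)
    (sym (+-congˡ (*-congˡ (sub (c * e) (d * f))))))

  distˡ-re : ∀ a b c d e f → a * (c + e) - b * (d + f) ≈ (a * c - b * d) + (a * e - b * f)
  distˡ-re a b c d e f = trans
    (+-cong (distribˡ a c e) (-‿cong (distribˡ b d f)))
    (+-sub-+ (a * c) (a * e) (b * d) (b * f))

  distˡ-im : ∀ a b c d e f → a * (d + f) + b * (c + e) ≈ (a * d + b * c) + (a * f + b * e)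
  distˡ-im = solve 6 (λ a b c d e f →
    a :* (d :+ f) :+ b :* (c :+ e) := (a :* d :+ b :* c) :+ (a :* f :+ b :* e)) refl

  distʳ-re : ∀ a b c d e f → (c + e) * a - (d + f) * b ≈ (c * a - d * b) + (e * a - f * b)
  distʳ-re a b c d e f = trans
    (+-cong (distribʳ a c e) (-‿cong (distribʳ b d f)))
    (+-sub-+ (c * a) (e * a) (d * b) (f * b))

  distʳ-im : ∀ a b c d e f → (c + e) * b + (d + f) * a ≈ (c * b + d * a) + (e * b + f * a)
  distʳ-im = solve 6 (λ a b c d e f →
    (c :+ e) :* b :+ (d :+ f) :* a := (c :* b :+ d :* a) :+ (e :* b :+ f :* a)) refl

  comm-re : ∀ a b c d → a * c - b * d ≈ c * a - d * b
  comm-re a b c d = +-cong (*-comm a c) (-‿cong (*-comm b d))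

  comm-im : ∀ a b c d → a * d + b * c ≈ c * b + d * a
  comm-im = solve 4 (λ a b c d → a :* d :+ b :* c := c :* b :+ d :* a) refl

  neg-sub : ∀ a b → - (a - b) ≈ b - a
  neg-sub = ⁻¹-anti-homo-//

  sub-add : ∀ a b → (a - b) + b ≈ a
  sub-add a b = //-rightDividesˡ b a

  sub-split : ∀ a b c → a - c ≈ (a - b) + (b - c)
  sub-split a b c = sym (trans (sym (+-assoc (a - b) b (- c))) (+-congʳ (sub-add a b)))

  *-sub-* : ∀ a b c d → (a * b) - (c * d) ≈ a * (b - d) + d * (a - c)
  *-sub-* a b c d = trans (sub-split (a * b) (a * d) (c * d))
    (+-cong (sym (x[y-z]≈xy-xz a b d))
      (trans (sym ([y-z]x≈yx-zx d a c)) (*-comm (a - c) d)))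

  *-idˡ-re : ∀ a b → 1# * a - 0# * b ≈ a
  *-idˡ-re a b = trans
    (+-cong (*-identityˡ a) (trans (-‿cong (zeroˡ b)) -0#≈0#)) (+-identityʳ a)

  *-idˡ-im : ∀ a b → 1# * b + 0# * a ≈ b
  *-idˡ-im a b = trans (+-cong (*-identityˡ b) (zeroˡ a)) (+-identityʳ b)

  *-idʳ-re : ∀ a b → a * 1# - b * 0# ≈ a
  *-idʳ-re a b = trans
    (+-cong (*-identityʳ a) (trans (-‿cong (zeroʳ b)) -0#≈0#)) (+-identityʳ a)

  *-idʳ-im : ∀ a b → a * 0# + b * 1# ≈ b
  *-idʳ-im a b = trans (+-cong (zeroʳ a) (*-identityʳ b)) (+-identityˡ b)

-- The real numbers as Cauchy sequences of rationals.

module Real where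

  open import Relation.Binary.PropositionalEquality
    using (_≡_; refl; sym; trans; cong; subst)
  open import Data.Rational.Base using (_+_; _*_; -_; _-_; ∣_∣; _<_; 1/_; ½; 0ℚ; 1ℚ)
  open RingIdentities ℚ.+-*-commutativeRing
    using (neg-sub; sub-add; sub-split; +-sub-+; neg-sub-neg; *-sub-*)

  -- On Cauchy sequences this says that the difference is null; on the diagonal
  -- it says that a sequence is Cauchy.
  infix 4 _∼_
  record _∼_ (x y : ℕ → ℚ) : Set where
    constructor mk∼
    field
      close : ∀ ε → .{{Positive ε}} →
              ∃[ N ] (∀ i j → N ℕ.≤ i → N ℕ.≤ j → ∣ x i - y j ∣ < ε)
  open _∼_ public

  private
    half-pos : ∀ ε → .{{Positive ε}} → Positive (ε * ½)
    half-pos ε = ℚ.pos*pos⇒pos ε ½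

    halves : ∀ ε → ε * ½ + ε * ½ ≡ ε
    halves ε = trans (sym (ℚ.*-distribˡ-+ ε ½ ½)) (ℚ.*-identityʳ ε)

    triangle : ∀ ε {a b c} → c ≡ a + b → ∣ a ∣ < ε * ½ → ∣ b ∣ < ε * ½ → ∣ c ∣ < ε
    triangle ε {a} {b} refl a< b< = ℚ.≤-<-trans (ℚ.∣p+q∣≤∣p∣+∣q∣ a b)
      (subst (∣ a ∣ + ∣ b ∣ <_) (halves ε) (ℚ.+-mono-< a< b<))

    flip-∣-∣ : ∀ a b → ∣ a - b ∣ ≡ ∣ b - a ∣
    flip-∣-∣ a b = trans (sym (ℚ.∣-p∣≡∣p∣ (a - b)))
      (cong ∣_∣ (neg-sub a b))

    quotient : ∀ ε A → .{{Positive ε}} → .{{Positive A}} →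
               ∃[ δ ] (Positive δ × A * δ ≡ ε)
    quotient ε A = A⁻¹ * ε , ℚ.pos*pos⇒pos A⁻¹ {{ℚ.1/pos⇒pos A}} ε ,
      trans (sym (ℚ.*-assoc A A⁻¹ ε))
        (trans (cong (_* ε) (ℚ.*-inverseʳ A {{ℚ.pos⇒nonZero A}})) (ℚ.*-identityˡ ε))
      where A⁻¹ = (1/ A) {{ℚ.pos⇒nonZero A}}

    product-bound : ∀ a b {A δ ε} → .{{Positive A}} → A * δ ≡ ε →
                    ∣ a ∣ < A → ∣ b ∣ < δ → ∣ a * b ∣ < ε
    product-bound a b {A} {δ} refl a< b< =
      subst (_< A * δ) (sym (ℚ.∣p*q∣≡∣p∣*∣q∣ a b))
        (ℚ.≤-<-trans
          (ℚ.*-monoʳ-≤-nonNeg ∣ b ∣ {{ℚ.∣-∣-nonNeg b}} (ℚ.<⇒≤ a<))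
          (ℚ.*-monoʳ-<-pos A b<))

    sum-bound : ∀ a b {ε} → ∣ a - b ∣ < ε → ∣ a ∣ < ε + ∣ b ∣
    sum-bound a b {ε} a-b< = ℚ.≤-<-trans
      (subst (λ z → ∣ z ∣ ℚ.≤ ∣ a - b ∣ + ∣ b ∣)
        (sub-add a b)
        (ℚ.∣p+q∣≤∣p∣+∣q∣ (a - b) b))
      (ℚ.+-monoˡ-< ∣ b ∣ a-b<)

  ∼-sym : ∀ {x y} → x ∼ y → y ∼ x
  ∼-sym {x} {y} p .close ε = case close p ε of λ where
    (N , h) → N , λ i j N≤i N≤j →
      subst (_< ε) (flip-∣-∣ (x j) (y i)) (h j i N≤j N≤i)

  ∼-trans : ∀ {x y z} → x ∼ y → y ∼ z → x ∼ z
  ∼-trans {x} {y} {z} p q .close ε = case close p (ε * ½) {{half-pos ε}} , close q (ε * ½) {{half-pos ε}} of λ where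
    ((M , f) , (N , g)) → M ℕ.⊔ N , λ i j ≤i ≤j →
      let k = M ℕ.⊔ N in
      triangle ε
        (sub-split (x i) (y k) (z j))
        (f i k (ℕ.m⊔n≤o⇒m≤o M N ≤i) (ℕ.m≤m⊔n M N))
        (g k j (ℕ.m≤n⊔m M N) (ℕ.m⊔n≤o⇒n≤o M N ≤j))

  ∼-+ : ∀ {x x′ y y′} → x ∼ x′ → y ∼ y′ → (λ i → x i + y i) ∼ (λ i → x′ i + y′ i)
  ∼-+ {x} {x′} {y} {y′} p q .close ε = case close p (ε * ½) {{half-pos ε}} , close q (ε * ½) {{half-pos ε}} of λ where
    ((M , f) , (N , g)) → M ℕ.⊔ N , λ i j ≤i ≤j →
      triangle ε
        (+-sub-+ (x i) (y i) (x′ j) (y′ j))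
        (f i j (ℕ.m⊔n≤o⇒m≤o M N ≤i) (ℕ.m⊔n≤o⇒m≤o M N ≤j))
        (g i j (ℕ.m⊔n≤o⇒n≤o M N ≤i) (ℕ.m⊔n≤o⇒n≤o M N ≤j))

  ∼-neg : ∀ {x x′} → x ∼ x′ → (λ i → - x i) ∼ (λ i → - x′ i)
  ∼-neg {x} {x′} p .close ε = case close p ε of λ where
    (N , h) → N , λ i j N≤i N≤j →
      subst (_< ε)
        (trans (sym (ℚ.∣-p∣≡∣p∣ (x i - x′ j)))
          (cong ∣_∣ (neg-sub-neg (x i) (x′ j))))
        (h i j N≤i N≤j)

  private
    bounded : ∀ {x y} → x ∼ y →
              ∃[ A ] (Positive A × ∃[ N ] (∀ i → N ℕ.≤ i → ∣ x i ∣ < A))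
    bounded {x} {y} p = case close p 1ℚ of λ where
      (N , h) → 1ℚ + ∣ y N ∣ , ℚ.pos+nonNeg⇒pos 1ℚ ∣ y N ∣ {{ℚ.∣-∣-nonNeg (y N)}} ,
        N , λ i N≤i → sum-bound (x i) (y N) (h i N N≤i ℕ.≤-refl)

  ∼-* : ∀ {x x′ y y′} → x ∼ x′ → y ∼ y′ → (λ i → x i * y i) ∼ (λ i → x′ i * y′ i)
  ∼-* {x} {x′} {y} {y′} p q .close ε with bounded p | bounded (∼-sym q)
  ... | A , A>0 , K , hK | B , B>0 , L , hL
    with quotient (ε * ½) A {{half-pos ε}} {{A>0}} | quotient (ε * ½) B {{half-pos ε}} {{B>0}}
  ... | α , α>0 , Aα | β , β>0 , Bβ with close q α {{α>0}} | close p β {{β>0}}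
  ... | M , f | N , g = (K ℕ.⊔ L) ℕ.⊔ (M ℕ.⊔ N) , λ i j ≤i ≤j →
    let KL≤i = ℕ.m⊔n≤o⇒m≤o (K ℕ.⊔ L) (M ℕ.⊔ N) ≤i
        KL≤j = ℕ.m⊔n≤o⇒m≤o (K ℕ.⊔ L) (M ℕ.⊔ N) ≤j
        MN≤i = ℕ.m⊔n≤o⇒n≤o (K ℕ.⊔ L) (M ℕ.⊔ N) ≤i
        MN≤j = ℕ.m⊔n≤o⇒n≤o (K ℕ.⊔ L) (M ℕ.⊔ N) ≤j
    in triangle ε
      (*-sub-* (x i) (y i) (x′ j) (y′ j))
      (product-bound (x i) (y i - y′ j) {{A>0}} Aα
        (hK i (ℕ.m⊔n≤o⇒m≤o K L KL≤i))
        (f i j (ℕ.m⊔n≤o⇒m≤o M N MN≤i) (ℕ.m⊔n≤o⇒m≤o M N MN≤j)))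
      (product-bound (y′ j) (x i - x′ j) {{B>0}} Bβ
        (hL j (ℕ.m⊔n≤o⇒n≤o K L KL≤j))
        (g i j (ℕ.m⊔n≤o⇒n≤o M N MN≤i) (ℕ.m⊔n≤o⇒n≤o M N MN≤j)))

  record ℝ : Set where
    constructor mkℝ
    field
      seq    : ℕ → ℚ
      cauchy : seq ∼ seq
  open ℝ public

  infix 4 _≈_
  record _≈_ (x y : ℝ) : Set where
    constructor mk≈
    field
      seq-∼ : seq x ∼ seq y
  open _≈_ public

  ≗⇒≈ : ∀ {x y} → (∀ i → seq x i ≡ seq y i) → x ≈ y
  ≗⇒≈ {x} {y} e = mk≈ (mk∼ λ ε → case close (cauchy x) ε of λ where
    (N , h) → N , λ i j N≤i N≤j →
      subst (λ z → ∣ seq x i - z ∣ < ε) (e j) (h i j N≤i N≤j))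

  fromℚ : ℚ → ℝ
  fromℚ q = mkℝ (λ _ → q) (mk∼ λ ε → 0 , λ _ _ _ _ →
    subst (_< ε) (sym (cong ∣_∣ (ℚ.+-inverseʳ q))) (ℚ.positive⁻¹ ε))

  infixl 6 _+ʳ_
  infixl 7 _*ʳ_

  _+ʳ_ : ℝ → ℝ → ℝ
  x +ʳ y = mkℝ (λ i → seq x i + seq y i) (∼-+ (cauchy x) (cauchy y))

  _*ʳ_ : ℝ → ℝ → ℝ
  x *ʳ y = mkℝ (λ i → seq x i * seq y i) (∼-* (cauchy x) (cauchy y))

  -ʳ_ : ℝ → ℝ
  -ʳ x = mkℝ (λ i → - seq x i) (∼-neg (cauchy x))

  ≈-isEquivalence : IsEquivalence _≈_
  ≈-isEquivalence = record
    { refl  = λ {x} → mk≈ (cauchy x)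
    ; sym   = λ p → mk≈ (∼-sym (seq-∼ p))
    ; trans = λ p q → mk≈ (∼-trans (seq-∼ p) (seq-∼ q))
    }

  ℝ-commutativeRing : CommutativeRing 0ℓ 0ℓ
  ℝ-commutativeRing = record
    { Carrier = ℝ
    ; _≈_ = _≈_
    ; _+_ = _+ʳ_
    ; _*_ = _*ʳ_
    ; -_  = -ʳ_
    ; 0#  = fromℚ 0ℚ
    ; 1#  = fromℚ 1ℚ
    ; isCommutativeRing = record
      { isRing = record
        { +-isAbelianGroup = record
          { isGroup = record
            { isMonoid = record
              { isSemigroup = record
                { isMagma = record
                  { isEquivalence = ≈-isEquivalence
                  ; ∙-cong = λ p q → mk≈ (∼-+ (seq-∼ p) (seq-∼ q))
                  }
                ; assoc = λ x y z → ≗⇒≈ λ i → ℚ.+-assoc (seq x i) (seq y i) (seq z i)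
                }
              ; identity = (λ x → ≗⇒≈ λ i → ℚ.+-identityˡ (seq x i))
                         , (λ x → ≗⇒≈ λ i → ℚ.+-identityʳ (seq x i))
              }
            ; inverse = (λ x → ≗⇒≈ λ i → ℚ.+-inverseˡ (seq x i))
                      , (λ x → ≗⇒≈ λ i → ℚ.+-inverseʳ (seq x i))
            ; ⁻¹-cong = λ p → mk≈ (∼-neg (seq-∼ p))
            }
          ; comm = λ x y → ≗⇒≈ λ i → ℚ.+-comm (seq x i) (seq y i)
          }
        ; *-cong = λ p q → mk≈ (∼-* (seq-∼ p) (seq-∼ q))
        ; *-assoc = λ x y z → ≗⇒≈ λ i → ℚ.*-assoc (seq x i) (seq y i) (seq z i)
        ; *-identity = (λ x → ≗⇒≈ λ i → ℚ.*-identityˡ (seq x i))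
                     , (λ x → ≗⇒≈ λ i → ℚ.*-identityʳ (seq x i))
        ; distrib = (λ x y z → ≗⇒≈ λ i → ℚ.*-distribˡ-+ (seq x i) (seq y i) (seq z i))
                  , (λ x y z → ≗⇒≈ λ i → ℚ.*-distribʳ-+ (seq x i) (seq y i) (seq z i))
        }
      ; *-comm = λ x y → ≗⇒≈ λ i → ℚ.*-comm (seq x i) (seq y i)
      }
    }

open Real using (ℝ; ℝ-commutativeRing) public

-- The ring R[i] with i² = -1, an element a + bi being the pair (a , b).

module Complexification {r ℓ} (R : CommutativeRing r ℓ) where

  open CommutativeRing R renaming (refl to ≈-refl; sym to ≈-sym; trans to ≈-trans)
  open RingIdentities R

  record R[i] : Set r where
    constructor _+i_
    field
      re im : Carrier
  open R[i] public

  infix 4 _≈ᶜ_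
  record _≈ᶜ_ (z w : R[i]) : Set ℓ where
    constructor _,_
    field
      re-≈ : re z ≈ re w
      im-≈ : im z ≈ im w
  open _≈ᶜ_ public

  R[i]-commutativeRing : CommutativeRing r ℓ
  R[i]-commutativeRing = record
    { Carrier = R[i]
    ; _≈_ = _≈ᶜ_
    ; _+_ = λ z w → (re z + re w) +i (im z + im w)
    ; _*_ = λ z w → (re z * re w - im z * im w) +i (re z * im w + im z * re w)
    ; -_  = λ z → (- re z) +i (- im z)
    ; 0#  = 0# +i 0#
    ; 1#  = 1# +i 0#
    ; isCommutativeRing = record
      { isRing = record
        { +-isAbelianGroup = record
          { isGroup = record
            { isMonoid = record
              { isSemigroup = record
                { isMagma = record
                  { isEquivalence = record
                    { refl = ≈-refl , ≈-refl
                    ; sym = λ (p , q) → ≈-sym p , ≈-sym q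
                    ; trans = λ (p , q) (p′ , q′) → ≈-trans p p′ , ≈-trans q q′
                    }
                  ; ∙-cong = λ (p , q) (p′ , q′) → +-cong p p′ , +-cong q q′
                  }
                ; assoc = λ (a +i b) (c +i d) (e +i f) → +-assoc a c e , +-assoc b d f
                }
              ; identity = (λ (a +i b) → +-identityˡ a , +-identityˡ b)
                         , (λ (a +i b) → +-identityʳ a , +-identityʳ b)
              }
            ; inverse = (λ (a +i b) → -‿inverseˡ a , -‿inverseˡ b)
                      , (λ (a +i b) → -‿inverseʳ a , -‿inverseʳ b)
            ; ⁻¹-cong = λ (p , q) → -‿cong p , -‿cong q
            }
          ; comm = λ (a +i b) (c +i d) → +-comm a c , +-comm b d
          }
        ; *-cong = λ (p , q) (p′ , q′) →
            +-cong (*-cong p p′) (-‿cong (*-cong q q′)) , +-cong (*-cong p q′) (*-cong q p′)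
        ; *-assoc = λ (a +i b) (c +i d) (e +i f) →
            *-assoc-re a b c d e f , *-assoc-im a b c d e f
        ; *-identity = (λ (a +i b) → *-idˡ-re a b , *-idˡ-im a b)
                     , (λ (a +i b) → *-idʳ-re a b , *-idʳ-im a b)
        ; distrib = (λ (a +i b) (c +i d) (e +i f) → distˡ-re a b c d e f , distˡ-im a b c d e f)
                  , (λ (a +i b) (c +i d) (e +i f) → distʳ-re a b c d e f , distʳ-im a b c d e f)
        }
      ; *-comm = λ (a +i b) (c +i d) → comm-re a b c d , comm-im a b c d
      }
    }

ℂ-commutativeRing : CommutativeRing 0ℓ 0ℓ
ℂ-commutativeRing = Complexification.R[i]-commutativeRing ℝ-commutativeRing

-- Only the ring structure of the coefficients is involved below, so everything
-- is set up over a commutative ring and used over ℂ.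

module PolynomialFamily {r ℓ} (K : CommutativeRing r ℓ) where

  open CommutativeRing K using (Carrier; _≈_; _+_; _*_; -_; 0#; 1#; semiring; +-rawMonoid)
  open import Algebra.Properties.Semiring.Exp semiring using (_^_)
  open import Algebra.Definitions.RawMonoid +-rawMonoid using (sum) renaming (_×_ to _·_)

  fromℕ : ℕ → Carrier
  fromℕ k = k · 1#

  [-1]^_ : ℕ → Carrier
  [-1]^ k = (- 1#) ^ k

  -- The sum of f over a ≤ k ≤ b, which is empty when b < a.
  ∑-range : ℕ → ℕ → (ℕ → Carrier) → Carrier
  ∑-range a b f = sum {suc b ∸ a} (λ k → f (a ℕ.+ toℕ k))

  infixr 5 ∑-range
  syntax ∑-range a b (λ k → x) = ∑[ k from a to b ] x

  -- The list a₀ ∷ a₁ ∷ … stands for a₀ + a₁ t + …; trailing zeros are allowed.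
  Polynomial : Set r
  Polynomial = List Carrier

  coeff : Polynomial → ℕ → Carrier
  coeff []      _       = 0#
  coeff (a ∷ _) zero    = a
  coeff (_ ∷ p) (suc k) = coeff p k

  eval : Polynomial → Carrier → Carrier
  eval []      t = 0#
  eval (a ∷ p) t = a + t * eval p t

  DegreeAtMost : ℕ → Polynomial → Set ℓ
  DegreeAtMost d p = ∀ k → d ℕ.< k → coeff p k ≈ 0#

  -- In a family E : ℕ → Polynomial only the members E 0, …, E n are used, and
  -- likewise for v; as j ≤ p ≤ n, the truncated subtractions are exact.

  c : ℕ → (ℕ → Carrier) → Carrier
  c n v = ∑[ p from 0 to n ] ([-1]^ (n ∸ p)) * fromℕ (suc p) * v p

  F : ℕ → (ℕ → Polynomial) → ℕ → Carrier → Carrier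
  F n E p t = ∑[ j from 0 to p ] ([-1]^ j) * fromℕ ((n ∸ j) C (n ∸ p)) * eval (E j) t

open CommutativeRing ℂ-commutativeRing public
  using (_≈_; _+_; _*_; _-_; -_) renaming (Carrier to ℂ)
open PolynomialFamily ℂ-commutativeRing public

fromℚ : ℚ → ℂ
fromℚ q = Complexification._+i_ (Real.fromℚ q) (Real.fromℚ ℚ.0ℚ)

½ : ℂ
½ = fromℚ ℚ.½

1/_! : ℕ → ℂ
1/ j ! = fromℚ ((+ 1 ℚ./ (j !)) {{j ℕ.!≢0}})

{-# OPTIONS --safe #-}
module Submission where

-- Since C(p+1, m+i) vanishes outside the range of summation, all sums may be
-- taken over rectangles and reordered so that the terms containing a fixed E_j
-- are collected.  The alternating sum over p that multiplies E_j(i) is a finite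
-- difference of p ↦ C(p+1, a+i), of order n − j, and collapses to
-- ± C(j+1, b−i) with a + b = n + 1; together with the coefficients of E_j(−i)
-- these are the coefficients of the difference of order j + 1 of t E_j(t) along
-- the points b, b−1, b−2, …  As t E_j(t) has degree at most j + 1, that difference
-- is (j+1)! times the coefficient of t^j in E_j, i.e. (j+1) v_j.  For odd n one
-- takes a = b = m; for even n one averages (a, b) = (m, m+1) and (m+1, m).

open import Defs using (module PolynomialFamily)
open import Algebra.Bundles using (CommutativeRing)
import Algebra.Definitions.RawMonoid
open import Data.Fin.Base using (toℕ)
open import Data.Fin.Permutation using (reverse)
open import Data.Fin.Properties using (toℕ<n; opposite-prop)
open import Data.Integer.Base as ℤ using (+_)
import Data.Integer.Properties as ℤ
open import Data.Integer.Tactic.RingSolver using (solve-∀)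
open import Data.List.Base using ([]; _∷_)
open import Data.Nat as ℕ using (ℕ; zero; suc; _≤_; _<_; _∸_; _/_; _!; z≤n; s≤s)
open import Data.Nat.Combinatorics using (_C_; nCk≡nC[n∸k]; k>n⇒nCk≡0; nCk+nC[k+1]≡[n+1]C[k+1])
open import Data.Nat.Divisibility using (_∣_; _∣0; ∣-refl; ∣m∣n⇒∣m+n)
open import Data.Nat.DivMod using (m*[n/m]≡n)
import Data.Nat.Properties as ℕ
open import Data.Product using (_×_; _,_)
import Data.Rational.Base as ℚ
open import Data.Rational.Base using (ℚ; fromℚᵘ)
import Data.Rational.Properties as ℚ
open import Data.Rational.Unnormalised.Base as ℚᵘ using (mkℚᵘ)
import Data.Rational.Unnormalised.Properties as ℚᵘ
open import Data.Sum.Base using (_⊎_; inj₁; inj₂; [_,_]′)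
open import Function.Base using (_∘_; id)
open import Relation.Binary.PropositionalEquality as ≡ using (_≡_)
open import Relation.Nullary using (¬_; contradiction)

open Algebra.Definitions.RawMonoid ℚ.+-0-rawMonoid using () renaming (_×_ to _·ℚ_)

-- Sums over initial segments of the natural numbers.

module InitialSums {r ℓ} (K : CommutativeRing r ℓ) where

  open CommutativeRing K
  open import Algebra.Definitions.RawMonoid +-rawMonoid using (sum)
  open import Algebra.Properties.CommutativeMonoid.Sum +-commutativeMonoid as Sum
    using (sum-cong-≋; sum-permute; sum-replicate-zero)
  open import Algebra.Properties.Semiring.Sum semiring using (*-distribˡ-sum)
  open import Relation.Binary.Reasoning.Setoid setoid

  -- Summands are functions on ℕ rather than on `Fin n`, so that one function can be summed over
  -- ranges of different lengths and shifted freely.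
  ∑< : ℕ → (ℕ → Carrier) → Carrier
  ∑< n f = sum {n} (λ k → f (toℕ k))

  infixr 5 ∑<
  syntax ∑< n (λ k → x) = ∑[ k < n ] x

  private
    variable
      f g : ℕ → Carrier

  ∑-cong : ∀ n → (∀ k → k < n → f k ≈ g k) → ∑< n f ≈ ∑< n g
  ∑-cong n e = sum-cong-≋ {n} (λ k → e (toℕ k) (toℕ<n k))

  ∑-zero : ∀ n → (∀ k → k < n → f k ≈ 0#) → ∑< n f ≈ 0#
  ∑-zero n e = trans (∑-cong n e) (sum-replicate-zero n)

  ∑-+ : ∀ n f g → ∑[ k < n ] (f k + g k) ≈ ∑< n f + ∑< n g
  ∑-+ n f g = Sum.∑-distrib-+ {n} (f ∘ toℕ) (g ∘ toℕ)

  ∑-swap : ∀ m n (h : ℕ → ℕ → Carrier) →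
           ∑[ i < m ] ∑[ k < n ] h i k ≈ ∑[ k < n ] ∑[ i < m ] h i k
  ∑-swap m n h = Sum.∑-comm {m} {n} (λ i k → h (toℕ i) (toℕ k))

  *-∑ : ∀ n x f → x * ∑< n f ≈ ∑[ k < n ] (x * f k)
  *-∑ n x f = *-distribˡ-sum {n} x (f ∘ toℕ)

  ∑-reverse : ∀ n f → ∑< n f ≈ ∑[ k < n ] f (n ∸ suc k)
  ∑-reverse n f = trans (sum-permute (f ∘ toℕ) (reverse {n}))
    (sum-cong-≋ {n} (λ k → reflexive (≡.cong f (opposite-prop k))))

  ∑-split : ∀ m n f → ∑< (m ℕ.+ n) f ≈ ∑< m f + (∑[ k < n ] f (m ℕ.+ k))
  ∑-split zero    n f = sym (+-identityˡ _)
  ∑-split (suc m) n f = trans (+-congˡ (∑-split m n (f ∘ suc))) (sym (+-assoc _ _ _))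

  ∑-dropˡ : ∀ m n f → (∀ k → k < m → f k ≈ 0#) → ∑< (m ℕ.+ n) f ≈ ∑[ k < n ] f (m ℕ.+ k)
  ∑-dropˡ m n f e = begin
    ∑< (m ℕ.+ n) f                      ≈⟨ ∑-split m n f ⟩
    ∑< m f + (∑[ k < n ] f (m ℕ.+ k))   ≈⟨ +-congʳ (∑-zero m e) ⟩
    0# + (∑[ k < n ] f (m ℕ.+ k))       ≈⟨ +-identityˡ _ ⟩
    ∑[ k < n ] f (m ℕ.+ k)              ∎

  ∑-dropʳ : ∀ {m n} f → m ≤ n → (∀ k → m ≤ k → k < n → f k ≈ 0#) → ∑< n f ≈ ∑< m f
  ∑-dropʳ {m} {n} f m≤n e = begin
    ∑< n f                                    ≡⟨ ≡.cong (λ k → ∑< k f) (ℕ.m+[n∸m]≡n m≤n) ⟨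
    ∑< (m ℕ.+ (n ∸ m)) f                      ≈⟨ ∑-split m (n ∸ m) f ⟩
    ∑< m f + (∑[ k < n ∸ m ] f (m ℕ.+ k))     ≈⟨ +-congˡ (∑-zero (n ∸ m) vanish) ⟩
    ∑< m f + 0#                               ≈⟨ +-identityʳ _ ⟩
    ∑< m f                                    ∎
    where
    vanish : ∀ k → k < n ∸ m → f (m ℕ.+ k) ≈ 0#
    vanish k k<n∸m = e (m ℕ.+ k) (ℕ.m≤m+n m k)
      (≡.subst (m ℕ.+ k <_) (ℕ.m+[n∸m]≡n m≤n) (ℕ.+-monoʳ-< m k<n∸m))

  -- Serves the average over two grids for even n: `f` and `g` are the two weights, `x` is the
  -- common scalar `half * σ`.
  ∑∑-linear : ∀ N x (f g e : ℕ → ℕ → Carrier) →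
    ∑[ p < N ] ∑[ k < N ] x * (f p k + g p k) * e p k
      ≈ x * ((∑[ p < N ] ∑[ k < N ] f p k * e p k) + (∑[ p < N ] ∑[ k < N ] g p k * e p k))
  ∑∑-linear N x f g e = begin
    (∑[ p < N ] ∑[ k < N ] x * (f p k + g p k) * e p k)
      ≈⟨ ∑-cong N (λ p _ → row p) ⟩
    (∑[ p < N ] x * (f′ p + g′ p))
      ≈⟨ *-∑ N x (λ p → f′ p + g′ p) ⟨
    x * (∑[ p < N ] (f′ p + g′ p))
      ≈⟨ *-congˡ (∑-+ N f′ g′) ⟩
    x * (∑< N f′ + ∑< N g′) ∎
    where
    f′ g′ : ℕ → Carrier
    f′ p = ∑[ k < N ] f p k * e p k
    g′ p = ∑[ k < N ] g p k * e p k
    row : ∀ p → (∑[ k < N ] x * (f p k + g p k) * e p k) ≈ x * (f′ p + g′ p)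
    row p = begin
      (∑[ k < N ] x * (f p k + g p k) * e p k)
        ≈⟨ ∑-cong N (λ k _ → trans (*-assoc x (f p k + g p k) (e p k)) (*-congˡ (distribʳ (e p k) (f p k) (g p k)))) ⟩
      (∑[ k < N ] x * (f p k * e p k + g p k * e p k))
        ≈⟨ *-∑ N x (λ k → f p k * e p k + g p k * e p k) ⟨
      x * (∑[ k < N ] (f p k * e p k + g p k * e p k))
        ≈⟨ *-congˡ (∑-+ N (λ k → f p k * e p k) (λ k → g p k * e p k)) ⟩
      x * (f′ p + g′ p) ∎

-- Signs, binomial coefficients and finite differences.

module Differences {r ℓ} (K : CommutativeRing r ℓ) where

  open CommutativeRing K
  open InitialSums K
  open PolynomialFamily K
  open import Algebra.Properties.Ring ring using (-1*x≈-x; -‿involutive)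
  open import Algebra.Properties.Semiring.Exp semiring using (^-homo-*)
  open import Algebra.Properties.Semiring.Mult semiring using (×-homo-+; ×-homo-1; ×1-homo-*)
  open import Algebra.Solver.Ring.NaturalCoefficients.Default commutativeSemiring
    using (solve; _:=_; _:+_; _:*_)
  open import Relation.Binary.Reasoning.Setoid setoid

  -- Negation is written as multiplication by σ, which makes the identities
  -- below accessible to the semiring solver.
  σ : Carrier
  σ = - 1#

  σσ≈1 : σ * σ ≈ 1#
  σσ≈1 = trans (-1*x≈-x σ) (-‿involutive 1#)

  x+σx≈0 : ∀ x → x + σ * x ≈ 0#
  x+σx≈0 x = trans (+-congˡ (-1*x≈-x x)) (-‿inverseʳ x)

  σσx≈x : ∀ x → σ * (σ * x) ≈ x
  σσx≈x x = trans (sym (*-assoc σ σ x)) (trans (*-congʳ σσ≈1) (*-identityˡ x))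

  fromℕ-+ : ∀ m n → fromℕ (m ℕ.+ n) ≈ fromℕ m + fromℕ n
  fromℕ-+ = ×-homo-+ 1#

  fromℕ-* : ∀ m n → fromℕ (m ℕ.* n) ≈ fromℕ m * fromℕ n
  fromℕ-* = ×1-homo-*

  [-1]^-+ : ∀ m n → [-1]^ (m ℕ.+ n) ≈ ([-1]^ m) * ([-1]^ n)
  [-1]^-+ = ^-homo-* σ

  [-1]^-square : ∀ k → ([-1]^ k) * ([-1]^ k) ≈ 1#
  [-1]^-square zero    = *-identityˡ 1#
  [-1]^-square (suc k) = begin
    (σ * [-1]^ k) * (σ * [-1]^ k)        ≈⟨ solve 2 (λ s q → (s :* q) :* (s :* q) := (s :* s) :* (q :* q)) refl σ ([-1]^ k) ⟩
    (σ * σ) * (([-1]^ k) * ([-1]^ k))    ≈⟨ *-cong σσ≈1 ([-1]^-square k) ⟩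
    1# * 1#                              ≈⟨ *-identityˡ 1# ⟩
    1#                                   ∎

  [-1]^-cancel : ∀ m n → [-1]^ (m ℕ.+ (m ℕ.+ n)) ≈ [-1]^ n
  [-1]^-cancel m n = begin
    [-1]^ (m ℕ.+ (m ℕ.+ n))                  ≈⟨ [-1]^-+ m (m ℕ.+ n) ⟩
    ([-1]^ m) * [-1]^ (m ℕ.+ n)              ≈⟨ *-congˡ ([-1]^-+ m n) ⟩
    ([-1]^ m) * (([-1]^ m) * [-1]^ n)        ≈⟨ *-assoc _ _ _ ⟨
    ([-1]^ m) * ([-1]^ m) * [-1]^ n          ≈⟨ *-congʳ ([-1]^-square m) ⟩
    1# * [-1]^ n                             ≈⟨ *-identityˡ _ ⟩
    [-1]^ n                                  ∎

  -- The two exponents differ by 2n. This trades the truncated exponents of the statement for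
  -- additive ones, which split by `[-1]^-+`.
  [-1]^-∸ : ∀ {m n} → n ≤ m → [-1]^ (m ∸ n) ≈ [-1]^ (m ℕ.+ n)
  [-1]^-∸ {m} {n} n≤m = begin
    [-1]^ (m ∸ n)                     ≈⟨ [-1]^-cancel n (m ∸ n) ⟨
    [-1]^ (n ℕ.+ (n ℕ.+ (m ∸ n)))     ≡⟨ ≡.cong (λ k → [-1]^ (n ℕ.+ k)) (ℕ.m+[n∸m]≡n n≤m) ⟩
    [-1]^ (n ℕ.+ m)                   ≡⟨ ≡.cong [-1]^_ (ℕ.+-comm n m) ⟩
    [-1]^ (m ℕ.+ n)                   ∎

  fromℕ[nCk]≈0 : ∀ {n k} → n < k → fromℕ (n C k) ≈ 0#
  fromℕ[nCk]≈0 n<k = reflexive (≡.cong fromℕ (k>n⇒nCk≡0 n<k))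

  pascal : ∀ n k → fromℕ (suc n C suc k) ≈ fromℕ (n C k) + fromℕ (n C suc k)
  pascal n k = trans (reflexive (≡.cong fromℕ (≡.sym (nCk+nC[k+1]≡[n+1]C[k+1] n k))))
    (fromℕ-+ (n C k) (n C suc k))

  -- This is (1 - S)^N for the shift S, not (S - 1)^N: the binomial expansion then has the signs
  -- (-1)^s, with no factor depending on N.
  Δ : ℕ → (ℕ → Carrier) → ℕ → Carrier
  Δ zero    u x = u x
  Δ (suc N) u x = Δ N u x + σ * Δ N u (suc x)

  Δ-cong : ∀ N {u w : ℕ → Carrier} → (∀ x → u x ≈ w x) → ∀ x → Δ N u x ≈ Δ N w x
  Δ-cong zero    e x = e x
  Δ-cong (suc N) e x = +-cong (Δ-cong N e x) (*-congˡ (Δ-cong N e (suc x)))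

  Δ-+ : ∀ N u w x → Δ N (λ s → u s + w s) x ≈ Δ N u x + Δ N w x
  Δ-+ zero    u w x = refl
  Δ-+ (suc N) u w x = trans (+-cong (Δ-+ N u w x) (*-congˡ (Δ-+ N u w (suc x))))
    (solve 5 (λ s a b c d → (a :+ b) :+ s :* (c :+ d) := (a :+ s :* c) :+ (b :+ s :* d)) refl
      σ _ _ _ _)

  Δ-const : ∀ N a x → Δ (suc N) (λ _ → a) x ≈ 0#
  Δ-const zero    a x = x+σx≈0 a
  Δ-const (suc N) a x = trans (+-cong (Δ-const N a x) (*-congˡ (Δ-const N a (suc x))))
    (trans (+-identityˡ _) (zeroʳ σ))

  -- Induction by Pascal's rule. Any bound M > N is allowed, since the coefficients vanish for s >
  -- N; the step uses this freedom, as its two sums have bounds M + 1 and M.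
  Δ-binomial : ∀ N u x M → N < M →
    ∑[ s < M ] ([-1]^ s) * fromℕ (N C s) * u (x ℕ.+ s) ≈ Δ N u x
  Δ-binomial zero u x (suc M) _ = begin
    1# * fromℕ 1 * u (x ℕ.+ 0) + (∑[ s < M ] ([-1]^ suc s) * fromℕ (0 C suc s) * u (x ℕ.+ suc s))
      ≈⟨ +-cong
           (*-cong (trans (*-identityˡ _) (×-homo-1 1#)) (reflexive (≡.cong u (ℕ.+-identityʳ x))))
           (∑-zero M (λ s _ → trans (*-congʳ (zeroʳ ([-1]^ suc s))) (zeroˡ (u (x ℕ.+ suc s))))) ⟩
    1# * u x + 0#  ≈⟨ +-identityʳ _ ⟩
    1# * u x       ≈⟨ *-identityˡ _ ⟩
    u x            ∎
  Δ-binomial (suc N) u x (suc M) (s≤s N<M) = begin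
    t 0 + (∑[ s < M ] ([-1]^ suc s) * fromℕ (suc N C suc s) * u (x ℕ.+ suc s))
      ≈⟨ +-congˡ (∑-cong M step) ⟩
    t 0 + (∑[ s < M ] (t (suc s) + σ * t′ s))
      ≈⟨ +-congˡ (∑-+ M (t ∘ suc) (λ s → σ * t′ s)) ⟩
    t 0 + (∑< M (t ∘ suc) + (∑[ s < M ] σ * t′ s))
      ≈⟨ +-assoc _ _ _ ⟨
    ∑< (suc M) t + (∑[ s < M ] σ * t′ s)
      ≈⟨ +-cong (Δ-binomial N u x (suc M) (ℕ.m<n⇒m<1+n N<M))
           (trans (sym (*-∑ M σ t′)) (*-congˡ (Δ-binomial N u (suc x) M N<M))) ⟩
    Δ N u x + σ * Δ N u (suc x) ∎
    where
    t t′ : ℕ → Carrier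
    t s = ([-1]^ s) * fromℕ (N C s) * u (x ℕ.+ s)
    t′ s = ([-1]^ s) * fromℕ (N C s) * u (suc x ℕ.+ s)
    step : ∀ s → s < M →
      ([-1]^ suc s) * fromℕ (suc N C suc s) * u (x ℕ.+ suc s) ≈ t (suc s) + σ * t′ s
    step s _ = begin
      σ * ([-1]^ s) * fromℕ (suc N C suc s) * u (x ℕ.+ suc s)
        ≈⟨ *-congʳ (*-congˡ (pascal N s)) ⟩
      σ * ([-1]^ s) * (fromℕ (N C s) + fromℕ (N C suc s)) * u (x ℕ.+ suc s)
        ≈⟨ solve 5 (λ s q a b w → s :* q :* (a :+ b) :* w := s :* q :* b :* w :+ s :* (q :* a :* w)) refl
             σ ([-1]^ s) _ _ _ ⟩
      t (suc s) + σ * (([-1]^ s) * fromℕ (N C s) * u (x ℕ.+ suc s))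
        ≡⟨ ≡.cong (λ y → t (suc s) + σ * (([-1]^ s) * fromℕ (N C s) * u y)) (ℕ.+-suc x s) ⟩
      t (suc s) + σ * t′ s ∎

  -- By Pascal's rule C(y, c+1) - C(y+1, c+1) = -C(y, c), so each difference lowers the bottom index
  -- by one and contributes one sign. Writing the index as `k + e` avoids a subtraction.
  Δ-choose : ∀ k e x → Δ k (λ y → fromℕ (y C (k ℕ.+ e))) x ≈ ([-1]^ k) * fromℕ (x C e)
  Δ-choose zero    e x = sym (*-identityˡ _)
  Δ-choose (suc k) e x = begin
    Δ k u x + σ * Δ k u (suc x)
      ≈⟨ +-cong (lower x) (*-congˡ (lower (suc x))) ⟩
    ([-1]^ k) * fromℕ (x C suc e) + σ * (([-1]^ k) * fromℕ (suc x C suc e))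
      ≈⟨ +-congˡ (*-congˡ (*-congˡ (pascal x e))) ⟩
    ([-1]^ k) * fromℕ (x C suc e) + σ * (([-1]^ k) * (fromℕ (x C e) + fromℕ (x C suc e)))
      ≈⟨ solve 4 (λ s q a b → q :* b :+ s :* (q :* (a :+ b)) := s :* q :* a :+ (q :* b :+ s :* (q :* b))) refl
           σ ([-1]^ k) _ _ ⟩
    σ * ([-1]^ k) * fromℕ (x C e)
      + (([-1]^ k) * fromℕ (x C suc e) + σ * (([-1]^ k) * fromℕ (x C suc e)))
      ≈⟨ +-congˡ (x+σx≈0 _) ⟩
    σ * ([-1]^ k) * fromℕ (x C e) + 0#
      ≈⟨ +-identityʳ _ ⟩
    σ * ([-1]^ k) * fromℕ (x C e) ∎
    where
    u : ℕ → Carrier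
    u y = fromℕ (y C (suc k ℕ.+ e))
    -- The index (k + 1) + e is read as k + (e + 1), so the induction hypothesis applies with e + 1.
    lower : ∀ x → Δ k u x ≈ ([-1]^ k) * fromℕ (x C suc e)
    lower x = trans
      (Δ-cong k (λ y → reflexive (≡.cong (λ c → fromℕ (y C c)) (≡.sym (ℕ.+-suc k e)))) x)
      (Δ-choose k (suc e) x)

  -- After c differences C(y, c) has become the constant ±1, and one more difference kills it.
  Δ-choose-zero : ∀ {k c} x → c < k → Δ k (λ y → fromℕ (y C c)) x ≈ 0#
  Δ-choose-zero {suc k} {c} x (s≤s c≤k) with ℕ.m≤n⇒m<n∨m≡n c≤k
  ... | inj₁ c<k = trans
    (+-cong (Δ-choose-zero x c<k) (*-congˡ (Δ-choose-zero (suc x) c<k)))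
    (trans (+-identityˡ _) (zeroʳ σ))
  ... | inj₂ ≡.refl = trans (+-cong (lower x) (*-congˡ (lower (suc x)))) (x+σx≈0 _)
    where
    lower : ∀ x → Δ k (λ y → fromℕ (y C k)) x ≈ ([-1]^ k) * fromℕ 1
    lower x = trans
      (Δ-cong k (λ y → reflexive (≡.cong (λ c → fromℕ (y C c)) (≡.sym (ℕ.+-identityʳ k)))) x)
      (Δ-choose k 0 x)

  -- As `y` falls by 1 at each step, its first difference is the constant 1 and its higher ones
  -- vanish. Hence only two terms of the Leibniz rule survive.
  Δ-leibniz : ∀ N (y h : ℕ → Carrier) → (∀ s → y (suc s) ≈ y s + σ) → ∀ s →
    Δ (suc N) (λ s → y s * h s) s ≈ y s * Δ (suc N) h s + fromℕ (suc N) * Δ N h (suc s)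
  Δ-leibniz zero y h e s = begin
    y s * h s + σ * (y (suc s) * h (suc s))
      ≈⟨ +-congˡ (*-congˡ (*-congʳ (e s))) ⟩
    y s * h s + σ * ((y s + σ) * h (suc s))
      ≈⟨ solve 4 (λ s y a b → y :* a :+ s :* ((y :+ s) :* b) := y :* (a :+ s :* b) :+ s :* s :* b) refl
           σ (y s) _ _ ⟩
    y s * (h s + σ * h (suc s)) + σ * σ * h (suc s)
      ≈⟨ +-congˡ (*-congʳ (trans σσ≈1 (sym (×-homo-1 1#)))) ⟩
    y s * (h s + σ * h (suc s)) + fromℕ 1 * h (suc s) ∎
  Δ-leibniz (suc N) y h e s = begin
    Δ (suc N) (λ s → y s * h s) s + σ * Δ (suc N) (λ s → y s * h s) (suc s)
      ≈⟨ +-cong (Δ-leibniz N y h e s) (*-congˡ (Δ-leibniz N y h e (suc s))) ⟩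
    (y s * A + k * B) + σ * (y (suc s) * A′ + k * B′)
      ≈⟨ +-congˡ (*-congˡ (+-congʳ (*-congʳ (e s)))) ⟩
    (y s * A + k * B) + σ * ((y s + σ) * A′ + k * B′)
      ≈⟨ solve 7 (λ s y k a a′ b b′ →
           (y :* a :+ k :* b) :+ s :* ((y :+ s) :* a′ :+ k :* b′) :=
           y :* (a :+ s :* a′) :+ (s :* s :* a′ :+ k :* (b :+ s :* b′))) refl
           σ (y s) k A A′ B B′ ⟩
    y s * (A + σ * A′) + (σ * σ * A′ + k * A′)
      ≈⟨ +-congˡ (+-congʳ (*-congʳ σσ≈1)) ⟩
    y s * (A + σ * A′) + (1# * A′ + k * A′)
      ≈⟨ +-congˡ (distribʳ _ _ _) ⟨
    y s * (A + σ * A′) + (1# + k) * A′ ∎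
    where
    k  = fromℕ (suc N)
    A  = Δ (suc N) h s
    A′ = Δ (suc N) h (suc s)
    B  = Δ N h (suc s)
    B′ = Δ N h (suc (suc s))

  -- Finite differences of polynomial values.

  eval-cong : ∀ p {x y} → x ≈ y → eval p x ≈ eval p y
  eval-cong []      e = refl
  eval-cong (a ∷ p) e = +-congˡ (*-cong e (eval-cong p e))

  -- Trailing zeros are allowed, so a degree bound does not make the tail of the list empty; it only
  -- makes its coefficients vanish.
  eval-zero : ∀ p → (∀ k → coeff p k ≈ 0#) → ∀ t → eval p t ≈ 0#
  eval-zero []      e t = refl
  eval-zero (a ∷ p) e t = trans
    (+-cong (e 0) (trans (*-congˡ (eval-zero p (e ∘ suc) t)) (zeroʳ t)))
    (+-identityˡ 0#)

  -- Induction on the list, using a + t p(t): the constant is killed and the product rule is applied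
  -- to t p(t). The order N + 1 difference of p vanishes because deg p ≤ N, and the other term
  -- supplies the factor N + 1 of the factorial.
  Δ-eval : ∀ p N → DegreeAtMost N p → ∀ (y : ℕ → Carrier) → (∀ s → y (suc s) ≈ y s + σ) → ∀ s →
    Δ N (λ s → eval p (y s)) s ≈ fromℕ (N !) * coeff p N
  Δ-eval [] zero    deg y e s = sym (zeroʳ _)
  Δ-eval [] (suc N) deg y e s = trans (Δ-const N 0# s) (sym (zeroʳ _))
  Δ-eval (a ∷ p) zero deg y e s = begin
    a + y s * eval p (y s)  ≈⟨ +-congˡ (*-congˡ (eval-zero p (λ k → deg (suc k) (s≤s z≤n)) (y s))) ⟩
    a + y s * 0#            ≈⟨ +-congˡ (zeroʳ _) ⟩
    a + 0#                  ≈⟨ +-identityʳ a ⟩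
    a                       ≈⟨ *-identityˡ a ⟨
    1# * a                  ≈⟨ *-congʳ (×-homo-1 1#) ⟨
    fromℕ 1 * a             ∎
  Δ-eval (a ∷ p) (suc N) deg y e s = begin
    Δ (suc N) (λ s → a + y s * h s) s
      ≈⟨ Δ-+ (suc N) (λ _ → a) (λ s → y s * h s) s ⟩
    Δ (suc N) (λ _ → a) s + Δ (suc N) (λ s → y s * h s) s
      ≈⟨ +-cong (Δ-const N a s) (Δ-leibniz N y h e s) ⟩
    0# + (y s * Δ (suc N) h s + fromℕ (suc N) * Δ N h (suc s))
      ≈⟨ +-identityˡ _ ⟩
    y s * Δ (suc N) h s + fromℕ (suc N) * Δ N h (suc s)
      ≈⟨ +-cong (*-congˡ (Δ-eval p (suc N) (λ k → deg (suc k) ∘ ℕ.m<n⇒m<1+n) y e s))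
                (*-congˡ (Δ-eval p N degp y e (suc s))) ⟩
    y s * (fromℕ (suc N !) * coeff p (suc N)) + fromℕ (suc N) * (fromℕ (N !) * coeff p N)
      ≈⟨ +-cong (trans (*-congˡ (trans (*-congˡ (degp (suc N) ℕ.≤-refl)) (zeroʳ _))) (zeroʳ _))
                (sym (*-assoc _ _ _)) ⟩
    0# + fromℕ (suc N) * fromℕ (N !) * coeff p N
      ≈⟨ +-identityˡ _ ⟩
    fromℕ (suc N) * fromℕ (N !) * coeff p N
      ≈⟨ *-congʳ (fromℕ-* (suc N) (N !)) ⟨
    fromℕ (suc N !) * coeff p N ∎
    where
    h : ℕ → Carrier
    h s = eval p (y s)
    degp : DegreeAtMost N p
    degp k N<k = deg (suc k) (s≤s N<k)

-- Alternating binomial sums and rectangular double sums.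

module CombinatorialSums {κ ℓ} (K : CommutativeRing κ ℓ) where

  open CommutativeRing K
  open InitialSums K
  open Differences K
  open PolynomialFamily K
  open import Algebra.Properties.Ring ring using (-1*x≈-x)
  open import Algebra.Solver.Ring.NaturalCoefficients.Default commutativeSemiring
    using (solve; _:=_; _:+_; _:*_)
  open import Relation.Binary.Reasoning.Setoid setoid

  -- Terms with p < j vanish. Putting p = j + q and k = n - j, the symmetry C(k, k - q) = C(k, q)
  -- shows a k-th difference of y ↦ C(y, c) at y = j + 1. This is ± C(j+1, c - k), which equals ±
  -- C(j+1, d) by symmetry, since (c - k) + d = j + 1.
  ∑-choose : ∀ {n j c d} → j ≤ n → c ℕ.+ d ≡ suc n →
    ∑[ p < suc n ] ([-1]^ p) * fromℕ ((n ∸ j) C (n ∸ p)) * fromℕ (suc p C c)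
      ≈ ([-1]^ n) * fromℕ (suc j C d)
  ∑-choose {n} {j} {c} {d} j≤n c+d≡1+n = begin
    ∑< (suc n) t                          ≡⟨ ≡.cong (λ N → ∑< N t) 1+n≡j+1+k ⟩
    ∑< (j ℕ.+ suc k) t                    ≈⟨ ∑-dropˡ j (suc k) t vanish ⟩
    ∑[ q < suc k ] t (j ℕ.+ q)            ≈⟨ ∑-cong (suc k) shift ⟩
    ∑[ q < suc k ] ([-1]^ j) * t′ q       ≈⟨ *-∑ (suc k) ([-1]^ j) t′ ⟨
    ([-1]^ j) * ∑< (suc k) t′             ≈⟨ *-congˡ (Δ-binomial k u (suc j) (suc k) ℕ.≤-refl) ⟩
    ([-1]^ j) * Δ k u (suc j)             ≈⟨ *-congˡ difference ⟩
    ([-1]^ j) * (([-1]^ k) * fromℕ (suc j C d))  ≈⟨ *-assoc _ _ _ ⟨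
    ([-1]^ j) * ([-1]^ k) * fromℕ (suc j C d)    ≈⟨ *-congʳ ([-1]^-+ j k) ⟨
    [-1]^ (j ℕ.+ k) * fromℕ (suc j C d)   ≡⟨ ≡.cong (λ N → [-1]^ N * fromℕ (suc j C d)) j+k≡n ⟩
    ([-1]^ n) * fromℕ (suc j C d)         ∎
    where
    k = n ∸ j
    j+k≡n : j ℕ.+ k ≡ n
    j+k≡n = ℕ.m+[n∸m]≡n j≤n
    1+n≡j+1+k : suc n ≡ j ℕ.+ suc k
    1+n≡j+1+k = ≡.trans (≡.cong suc (≡.sym j+k≡n)) (≡.sym (ℕ.+-suc j k))
    c+d≡k+1+j : c ℕ.+ d ≡ k ℕ.+ suc j
    c+d≡k+1+j = ≡.trans c+d≡1+n (≡.trans (≡.cong suc (≡.sym j+k≡n)) (ℕ.+-comm (suc j) k))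
    u t t′ : ℕ → Carrier
    u y = fromℕ (y C c)
    t p = ([-1]^ p) * fromℕ (k C (n ∸ p)) * u (suc p)
    t′ q = ([-1]^ q) * fromℕ (k C q) * u (suc j ℕ.+ q)
    vanish : ∀ p → p < j → t p ≈ 0#
    vanish p p<j = trans
      (*-congʳ (trans (*-congˡ (fromℕ[nCk]≈0 (ℕ.∸-monoʳ-< p<j j≤n))) (zeroʳ ([-1]^ p))))
      (zeroˡ (u (suc p)))
    shift : ∀ q → q < suc k → t (j ℕ.+ q) ≈ ([-1]^ j) * t′ q
    shift q (s≤s q≤k) = begin
      [-1]^ (j ℕ.+ q) * fromℕ (k C (n ∸ (j ℕ.+ q))) * u (suc j ℕ.+ q)
        ≡⟨ ≡.cong (λ N → [-1]^ (j ℕ.+ q) * fromℕ N * u (suc j ℕ.+ q))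
             (≡.trans (≡.cong (k C_) (≡.sym (ℕ.∸-+-assoc n j q))) (≡.sym (nCk≡nC[n∸k] q≤k))) ⟩
      [-1]^ (j ℕ.+ q) * fromℕ (k C q) * u (suc j ℕ.+ q)
        ≈⟨ *-congʳ (*-congʳ ([-1]^-+ j q)) ⟩
      ([-1]^ j) * ([-1]^ q) * fromℕ (k C q) * u (suc j ℕ.+ q)
        ≈⟨ trans (*-congʳ (*-assoc _ _ _)) (*-assoc _ _ _) ⟩
      ([-1]^ j) * t′ q ∎
    difference : Δ k u (suc j) ≈ ([-1]^ k) * fromℕ (suc j C d)
    -- If d > j + 1, then c < k: the difference vanishes, and so does C(j+1, d).
    difference with ℕ.≤-<-connex d (suc j)
    ... | inj₁ d≤1+j = begin
      Δ k u (suc j)                               ≡⟨ ≡.cong (λ b → Δ k (λ y → fromℕ (y C b)) (suc j)) c≡k+e ⟩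
      Δ k (λ y → fromℕ (y C (k ℕ.+ e))) (suc j)   ≈⟨ Δ-choose k e (suc j) ⟩
      ([-1]^ k) * fromℕ (suc j C e)               ≡⟨ ≡.cong (λ N → ([-1]^ k) * fromℕ N) (nCk≡nC[n∸k] d≤1+j) ⟨
      ([-1]^ k) * fromℕ (suc j C d)               ∎
      where
      e = suc j ∸ d
      c≡k+e : c ≡ k ℕ.+ e
      c≡k+e = ℕ.+-cancelʳ-≡ d c (k ℕ.+ e) (≡.trans c+d≡k+1+j
        (≡.trans (≡.cong (k ℕ.+_) (≡.sym (ℕ.m∸n+n≡m d≤1+j))) (≡.sym (ℕ.+-assoc k e d))))
    ... | inj₂ 1+j<d = trans (Δ-choose-zero (suc j) c<k)
      (sym (trans (*-congˡ (fromℕ[nCk]≈0 1+j<d)) (zeroʳ _)))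
      where
      c<k : c < k
      c<k = ℕ.+-cancelʳ-< d c k (≡.subst (_< k ℕ.+ d) (≡.sym c+d≡k+1+j) (ℕ.+-monoʳ-< k 1+j<d))

  -- Covers the c for which no d with c + d = n + 1 exists: c then exceeds every p + 1 in the sum.
  ∑-choose-zero : ∀ {n j c} → suc n < c →
    ∑[ p < suc n ] ([-1]^ p) * fromℕ ((n ∸ j) C (n ∸ p)) * fromℕ (suc p C c) ≈ 0#
  ∑-choose-zero {n} {j} 1+n<c = ∑-zero (suc n) λ p p<1+n →
    trans (*-congˡ (fromℕ[nCk]≈0 (ℕ.≤-<-trans p<1+n 1+n<c)))
      (zeroʳ (([-1]^ p) * fromℕ ((n ∸ j) C (n ∸ p))))

  -- The condition i ≤ p + 1 - m says m + i ≤ p + 1, and outside it `w′` vanishes, so the range can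
  -- be enlarged to a square. The weight `w` of the statement involves truncated subtraction and has
  -- to agree with `w′` only inside the range.
  ∑∑-rectangular : ∀ n m (w w′ e : ℕ → ℕ → Carrier) → m ≤ suc n →
    (∀ p i → m ℕ.+ suc i ≤ suc p → w p (suc i) ≈ w′ p (suc i)) →
    (∀ p i → suc p < m ℕ.+ i → w′ p i ≈ 0#) →
    ∑-range m n (λ p → ∑-range 1 (p ℕ.+ 1 ∸ m) (λ i → w p i * e p i))
      ≈ ∑[ p < suc n ] ∑[ k < suc n ] w′ p (suc k) * e p (suc k)
  ∑∑-rectangular n m w w′ e m≤1+n w≈w′ w′≈0 = begin
    (∑[ q < suc n ∸ m ] ∑[ k < m ℕ.+ q ℕ.+ 1 ∸ m ] w (m ℕ.+ q) (suc k) * e (m ℕ.+ q) (suc k))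
      ≈⟨ ∑-cong (suc n ∸ m) row ⟩
    (∑[ q < suc n ∸ m ] rect (m ℕ.+ q))
      ≈⟨ ∑-dropˡ m (suc n ∸ m) rect low ⟨
    ∑< (m ℕ.+ (suc n ∸ m)) rect
      ≡⟨ ≡.cong (λ N → ∑< N rect) (ℕ.m+[n∸m]≡n m≤1+n) ⟩
    ∑< (suc n) rect ∎
    where
    cell : ℕ → ℕ → Carrier
    cell p k = w′ p (suc k) * e p (suc k)
    rect : ℕ → Carrier
    rect p = ∑[ k < suc n ] cell p k
    cell≈0 : ∀ p k → suc p < m ℕ.+ suc k → cell p k ≈ 0#
    cell≈0 p k lt = trans (*-congʳ (w′≈0 p (suc k) lt)) (zeroˡ _)
    -- For p < m already i = 1 gives m + i > p + 1.
    low : ∀ p → p < m → rect p ≈ 0#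
    low p p<m = ∑-zero (suc n) (λ k _ →
      cell≈0 p k (ℕ.≤-<-trans p<m (ℕ.m<m+n m (s≤s z≤n))))
    row : ∀ q → q < suc n ∸ m →
      (∑[ k < m ℕ.+ q ℕ.+ 1 ∸ m ] w (m ℕ.+ q) (suc k) * e (m ℕ.+ q) (suc k)) ≈ rect (m ℕ.+ q)
    row q q<1+n∸m = begin
      (∑[ k < p ℕ.+ 1 ∸ m ] w p (suc k) * e p (suc k))
        ≡⟨ ≡.cong (λ N → ∑[ k < N ] w p (suc k) * e p (suc k)) length≡ ⟩
      (∑[ k < suc q ] w p (suc k) * e p (suc k))
        ≈⟨ ∑-cong (suc q) (λ k k<1+q → *-congʳ {x = e p (suc k)} (w≈w′ p k (≡.subst (m ℕ.+ suc k ≤_) (ℕ.+-suc m q) (ℕ.+-monoʳ-≤ m k<1+q)))) ⟩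
      ∑< (suc q) (cell p)
        ≈⟨ ∑-dropʳ (cell p) 1+q≤1+n (λ k q<k _ → cell≈0 p k
             (≡.subst (_< m ℕ.+ suc k) (ℕ.+-suc m q) (ℕ.+-monoʳ-< m (s≤s q<k)))) ⟨
      rect p ∎
      where
      p = m ℕ.+ q
      length≡ : p ℕ.+ 1 ∸ m ≡ suc q
      length≡ = ≡.trans (≡.cong (_∸ m) (≡.trans (ℕ.+-assoc m q 1) (≡.cong (m ℕ.+_) (ℕ.+-comm q 1))))
        (ℕ.m+n∸m≡n m (suc q))
      1+q≤1+n : suc q ≤ suc n
      1+q≤1+n = ℕ.≤-trans q<1+n∸m (ℕ.m∸n≤m (suc n) m)

  -- The exponent p + a + i has the parity of the paper's p + a − i, without
  -- truncation.
  weight : ℕ → ℕ → ℕ → Carrier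
  weight a p i = [-1]^ (p ℕ.+ a ℕ.+ i) * fromℕ (suc p C (a ℕ.+ i)) * fromℕ i

  weight-zero : ∀ a {p i} → suc p < a ℕ.+ i → weight a p i ≈ 0#
  weight-zero a {p} {i} lt = trans (*-congʳ (trans (*-congˡ (fromℕ[nCk]≈0 lt)) (zeroʳ _))) (zeroˡ _)

  -- Contributions of a single member of the family.

  module _ (n : ℕ) (E : ℕ → Polynomial) where

    -- The parts of `grid a` that contain E_j at negative points and, through F, at positive points.
    -- The names refer to the indices s = b + i and s = b - i at which these points occur in the
    -- progression b - s.
    above below : ℕ → ℕ → Carrier
    above a j = ∑[ k < suc n ] weight a j (suc k) * eval (E j) (- fromℕ (suc k))
    below a j = ∑[ k < suc n ] ∑[ p < suc n ]
      weight a p (suc k) * (([-1]^ j) * fromℕ ((n ∸ j) C (n ∸ p)) * eval (E j) (fromℕ (suc k)))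

    grid : ℕ → Carrier
    grid a = ∑[ p < suc n ] ∑[ k < suc n ]
      weight a p (suc k) * (eval (E p) (- fromℕ (suc k)) + F n E p (fromℕ (suc k)))

    F-rectangular : ∀ {p} → p ≤ n → ∀ t →
      F n E p t ≈ ∑[ j < suc n ] ([-1]^ j) * fromℕ ((n ∸ j) C (n ∸ p)) * eval (E j) t
    F-rectangular {p} p≤n t = sym (∑-dropʳ term (s≤s p≤n) vanish)
      where
      term : ℕ → Carrier
      term j = ([-1]^ j) * fromℕ ((n ∸ j) C (n ∸ p)) * eval (E j) t
      vanish : ∀ j → p < j → j < suc n → term j ≈ 0#
      vanish j p<j (s≤s j≤n) = trans
        (*-congʳ (trans (*-congˡ (fromℕ[nCk]≈0 (ℕ.∸-monoʳ-< p<j j≤n))) (zeroʳ ([-1]^ j))))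
        (zeroˡ (eval (E j) t))

    -- F is expanded over all j ≤ n, which is harmless by `F-rectangular`, and three exchanges of
    -- summation bring j outermost.
    grid-split : ∀ a → grid a ≈ ∑< (suc n) (above a) + ∑< (suc n) (below a)
    grid-split a = begin
      (∑[ p < N ] ∑[ k < N ] w p k * (e p k + F n E p (fromℕ (suc k))))
        ≈⟨ ∑-cong N (λ p p<N → trans (∑-cong N (λ k _ → expand p p<N k)) (∑-+ N (λ k → w p k * e p k) (λ k → ∑< N (φ p k)))) ⟩
      (∑[ p < N ] (above a p + (∑[ k < N ] ∑< N (φ p k))))
        ≈⟨ ∑-+ N (above a) (λ p → ∑[ k < N ] ∑< N (φ p k)) ⟩
      ∑< N (above a) + (∑[ p < N ] ∑[ k < N ] ∑[ j < N ] φ p k j)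
        ≈⟨ +-congˡ (∑-cong N (λ p _ → ∑-swap N N (φ p))) ⟩
      ∑< N (above a) + (∑[ p < N ] ∑[ j < N ] ∑[ k < N ] φ p k j)
        ≈⟨ +-congˡ (∑-swap N N (λ p j → ∑[ k < N ] φ p k j)) ⟩
      ∑< N (above a) + (∑[ j < N ] ∑[ p < N ] ∑[ k < N ] φ p k j)
        ≈⟨ +-congˡ (∑-cong N (λ j _ → ∑-swap N N (λ p k → φ p k j))) ⟩
      ∑< N (above a) + ∑< N (below a) ∎
      where
      N = suc n
      w e : ℕ → ℕ → Carrier
      w p k = weight a p (suc k)
      e p k = eval (E p) (- fromℕ (suc k))
      φ : ℕ → ℕ → ℕ → Carrier
      φ p k j = w p k * (([-1]^ j) * fromℕ ((n ∸ j) C (n ∸ p)) * eval (E j) (fromℕ (suc k)))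
      expand : ∀ p → p < N → ∀ k →
        w p k * (e p k + F n E p (fromℕ (suc k))) ≈ w p k * e p k + ∑< N (φ p k)
      expand p (s≤s p≤n) k = trans (distribˡ _ _ _)
        (+-congˡ (trans (*-congˡ (F-rectangular p≤n (fromℕ (suc k)))) (*-∑ N (w p k)
          (λ j → ([-1]^ j) * fromℕ ((n ∸ j) C (n ∸ p)) * eval (E j) (fromℕ (suc k))))))

    -- The factor `σ` turns i into -i, so that the summand contains t E_j(t) at t = -i.
    σ*above : ∀ b j → σ * above b j ≈
      ([-1]^ j) * (∑[ k < suc n ] ([-1]^ (b ℕ.+ suc k)) * fromℕ (suc j C (b ℕ.+ suc k))
        * (σ * fromℕ (suc k) * eval (E j) (- fromℕ (suc k))))
    σ*above b j = begin
      σ * above b j                    ≈⟨ *-∑ (suc n) σ term ⟩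
      (∑[ k < suc n ] σ * term k)      ≈⟨ ∑-cong (suc n) (λ k _ → pointwise k) ⟩
      (∑[ k < suc n ] q * term′ k)     ≈⟨ *-∑ (suc n) q term′ ⟨
      q * ∑< (suc n) term′             ∎
      where
      q = [-1]^ j
      term term′ : ℕ → Carrier
      term k = weight b j (suc k) * eval (E j) (- fromℕ (suc k))
      term′ k = ([-1]^ (b ℕ.+ suc k)) * fromℕ (suc j C (b ℕ.+ suc k))
        * (σ * fromℕ (suc k) * eval (E j) (- fromℕ (suc k)))
      pointwise : ∀ k → σ * term k ≈ q * term′ k
      pointwise k = begin
        σ * ([-1]^ (j ℕ.+ b ℕ.+ suc k) * x * i * h)
          ≡⟨ ≡.cong (λ N → σ * ([-1]^ N * x * i * h)) (ℕ.+-assoc j b (suc k)) ⟩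
        σ * ([-1]^ (j ℕ.+ (b ℕ.+ suc k)) * x * i * h)
          ≈⟨ *-congˡ (*-congʳ (*-congʳ (*-congʳ ([-1]^-+ j (b ℕ.+ suc k))))) ⟩
        σ * (q * [-1]^ (b ℕ.+ suc k) * x * i * h)
          ≈⟨ solve 6 (λ s q r x i h → s :* (q :* r :* x :* i :* h) := q :* (r :* x :* (s :* i :* h))) refl
               σ q ([-1]^ (b ℕ.+ suc k)) x i h ⟩
        q * term′ k ∎
        where
        x = fromℕ (suc j C (b ℕ.+ suc k))
        i = fromℕ (suc k)
        h = eval (E j) (- fromℕ (suc k))

    -- The inner sum over p is `∑-choose` with c = a + i and d = b - i; for i > b it is zero by
    -- `∑-choose-zero`, which cuts the range down to i ≤ b.
    σ*below : ∀ {a b j} → a ℕ.+ b ≡ suc n → j ≤ n → σ * below a j ≈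
      ([-1]^ j) * (∑[ k < b ] ([-1]^ (b ∸ suc k)) * fromℕ (suc j C (b ∸ suc k))
        * (fromℕ (suc k) * eval (E j) (fromℕ (suc k))))
    σ*below {a} {b} {j} a+b≡1+n j≤n = begin
      σ * below a j                          ≈⟨ *-congˡ (∑-cong (suc n) (λ k _ → factor k)) ⟩
      σ * (∑[ k < suc n ] r k * S k)         ≈⟨ *-congˡ (∑-dropʳ (λ k → r k * S k) b≤1+n vanish) ⟩
      σ * (∑[ k < b ] r k * S k)             ≈⟨ *-∑ b σ (λ k → r k * S k) ⟩
      (∑[ k < b ] σ * (r k * S k))           ≈⟨ ∑-cong b pointwise ⟩
      (∑[ k < b ] q * term k)                ≈⟨ *-∑ b q term ⟨
      q * ∑< b term                          ∎
      where
      q = [-1]^ j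
      h r S term : ℕ → Carrier
      h k = eval (E j) (fromℕ (suc k))
      r k = q * ([-1]^ (a ℕ.+ suc k) * fromℕ (suc k) * h k)
      summand : ℕ → ℕ → Carrier
      summand k p = ([-1]^ p) * fromℕ ((n ∸ j) C (n ∸ p)) * fromℕ (suc p C (a ℕ.+ suc k))
      S k = ∑< (suc n) (summand k)
      term k = ([-1]^ (b ∸ suc k)) * fromℕ (suc j C (b ∸ suc k)) * (fromℕ (suc k) * h k)
      b≤1+n : b ≤ suc n
      b≤1+n = ≡.subst (b ≤_) a+b≡1+n (ℕ.m≤n+m b a)
      factor : ∀ k →
        (∑[ p < suc n ] weight a p (suc k) * (q * fromℕ ((n ∸ j) C (n ∸ p)) * h k)) ≈ r k * S k
      factor k = trans (∑-cong (suc n) (λ p _ → pull p)) (sym (*-∑ (suc n) (r k) (summand k)))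
        where
        pull : ∀ p →
          weight a p (suc k) * (q * fromℕ ((n ∸ j) C (n ∸ p)) * h k) ≈ r k * summand k p
        pull p = begin
          [-1]^ (p ℕ.+ a ℕ.+ suc k) * x * fromℕ (suc k) * (q * y * h k)
            ≡⟨ ≡.cong (λ N → [-1]^ N * x * fromℕ (suc k) * (q * y * h k)) (ℕ.+-assoc p a (suc k)) ⟩
          [-1]^ (p ℕ.+ (a ℕ.+ suc k)) * x * fromℕ (suc k) * (q * y * h k)
            ≈⟨ *-congʳ (*-congʳ (*-congʳ ([-1]^-+ p (a ℕ.+ suc k)))) ⟩
          ([-1]^ p) * [-1]^ (a ℕ.+ suc k) * x * fromℕ (suc k) * (q * y * h k)
            ≈⟨ solve 7 (λ P A x i q y h →
                 P :* A :* x :* i :* (q :* y :* h) := q :* (A :* i :* h) :* (P :* y :* x)) refl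
                 ([-1]^ p) ([-1]^ (a ℕ.+ suc k)) x (fromℕ (suc k)) q y (h k) ⟩
          r k * summand k p ∎
          where
          x = fromℕ (suc p C (a ℕ.+ suc k))
          y = fromℕ ((n ∸ j) C (n ∸ p))
      vanish : ∀ k → b ≤ k → k < suc n → r k * S k ≈ 0#
      vanish k b≤k _ = trans (*-congˡ (∑-choose-zero {n} {j}
          (≡.subst (_< a ℕ.+ suc k) a+b≡1+n (ℕ.+-monoʳ-< a (s≤s b≤k))))) (zeroʳ _)
      pointwise : ∀ k → k < b → σ * (r k * S k) ≈ q * term k
      pointwise k k<b = begin
        σ * (r k * S k)
          ≈⟨ *-congˡ (*-congˡ (∑-choose {c = a ℕ.+ suc k} {d = b ∸ suc k} j≤n total)) ⟩
        σ * (q * (A * i * h k) * (([-1]^ n) * x))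
          ≈⟨ solve 7 (λ s q A i h e x →
               s :* (q :* (A :* i :* h) :* (e :* x)) := q :* (A :* (s :* e) :* x :* (i :* h))) refl
               σ q A i (h k) ([-1]^ n) x ⟩
        q * (A * ([-1]^ suc n) * x * (i * h k))
          ≈⟨ *-congˡ (*-congʳ (*-congʳ sign)) ⟩
        q * term k ∎
        where
        A = [-1]^ (a ℕ.+ suc k)
        i = fromℕ (suc k)
        x = fromℕ (suc j C (b ∸ suc k))
        total : (a ℕ.+ suc k) ℕ.+ (b ∸ suc k) ≡ suc n
        total = ≡.trans (ℕ.+-assoc a (suc k) _)
          (≡.trans (≡.cong (a ℕ.+_) (ℕ.m+[n∸m]≡n k<b)) a+b≡1+n)
        -- Since n + 1 = (a + i) + (b - i), the exponent a + i occurs twice and cancels.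
        sign : A * ([-1]^ suc n) ≈ [-1]^ (b ∸ suc k)
        sign = begin
          A * ([-1]^ suc n)  ≡⟨ ≡.cong (λ N → A * [-1]^ N) total ⟨
          A * [-1]^ (a ℕ.+ suc k ℕ.+ (b ∸ suc k))  ≈⟨ [-1]^-+ (a ℕ.+ suc k) _ ⟨
          [-1]^ (a ℕ.+ suc k ℕ.+ (a ℕ.+ suc k ℕ.+ (b ∸ suc k)))  ≈⟨ [-1]^-cancel (a ℕ.+ suc k) (b ∸ suc k) ⟩
          [-1]^ (b ∸ suc k)  ∎

    -- The two sums are the terms s > b and s < b in the binomial expansion of the difference of
    -- order j + 1 of t E_j(t) along t = b - s. The missing term s = b is zero, because t = 0 there.
    σ*[above+below] : ∀ {a b j} → a ℕ.+ b ≡ suc n → j ≤ n → DegreeAtMost j (E j) →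
      σ * (above b j + below a j) ≈ ([-1]^ j) * (fromℕ (suc j !) * coeff (E j) j)
    σ*[above+below] {a} {b} {j} a+b≡1+n j≤n deg = begin
      σ * (above b j + below a j)
        ≈⟨ distribˡ σ _ _ ⟩
      σ * above b j + σ * below a j
        ≈⟨ +-cong (σ*above b j) (σ*below a+b≡1+n j≤n) ⟩
      q * ∑< (suc n) upper + q * ∑< b lower
        ≈⟨ distribˡ q _ _ ⟨
      q * (∑< (suc n) upper + ∑< b lower)
        ≈⟨ *-congˡ (+-comm _ _) ⟩
      q * (∑< b lower + ∑< (suc n) upper)
        -- The lower terms are listed by i = b - s and hence reversed; the upper range of length n +
        -- 2 starts with the vanishing term s = b.
        ≈⟨ *-congˡ (+-cong (trans (∑-reverse b t) (∑-cong b lower≈))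
             (trans (+-congʳ middle≈) (trans (+-identityˡ _) (∑-cong (suc n) (λ k _ → upper≈ k))))) ⟨
      q * (∑< b t + (∑[ k < suc (suc n) ] t (b ℕ.+ k)))
        ≈⟨ *-congˡ (∑-split b (suc (suc n)) t) ⟨
      q * ∑< (b ℕ.+ suc (suc n)) t
        ≈⟨ *-congˡ (Δ-binomial (suc j) (λ s → y s * h s) 0 _ (ℕ.m≤n⇒m≤o+n b (s≤s (s≤s j≤n)))) ⟩
      q * Δ (suc j) (λ s → y s * h s) 0
        ≈⟨ *-congˡ (Δ-cong (suc j) (λ s → +-identityˡ _) 0) ⟨
      q * Δ (suc j) (λ s → eval (0# ∷ E j) (y s)) 0
        -- Prefixing 0 multiplies by t, so the coefficient of degree j + 1 is that of degree j in
        -- `E j`.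
        ≈⟨ *-congˡ (Δ-eval (0# ∷ E j) (suc j) (λ { (suc k) (s≤s j<k) → deg k j<k }) y y-step 0) ⟩
      q * (fromℕ (suc j !) * coeff (E j) j) ∎
      where
      q = [-1]^ j
      y h t lower upper : ℕ → Carrier
      y s = fromℕ b + σ * fromℕ s
      h s = eval (E j) (y s)
      t s = ([-1]^ s) * fromℕ (suc j C s) * (y s * h s)
      lower k = ([-1]^ (b ∸ suc k)) * fromℕ (suc j C (b ∸ suc k))
        * (fromℕ (suc k) * eval (E j) (fromℕ (suc k)))
      upper k = ([-1]^ (b ℕ.+ suc k)) * fromℕ (suc j C (b ℕ.+ suc k))
        * (σ * fromℕ (suc k) * eval (E j) (- fromℕ (suc k)))
      y-step : ∀ s → y (suc s) ≈ y s + σ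
      y-step s = begin
        fromℕ b + σ * (1# + fromℕ s)       ≈⟨ +-congˡ (distribˡ σ _ _) ⟩
        fromℕ b + (σ * 1# + σ * fromℕ s)   ≈⟨ +-congˡ (+-comm _ _) ⟩
        fromℕ b + (σ * fromℕ s + σ * 1#)   ≈⟨ +-assoc _ _ _ ⟨
        y s + σ * 1#                       ≈⟨ +-congˡ (*-identityʳ σ) ⟩
        y s + σ                            ∎
      y-above : ∀ k → y (b ℕ.+ k) ≈ σ * fromℕ k
      y-above k = begin
        fromℕ b + σ * fromℕ (b ℕ.+ k)                 ≈⟨ +-congˡ (*-congˡ (fromℕ-+ b k)) ⟩
        fromℕ b + σ * (fromℕ b + fromℕ k)             ≈⟨ +-congˡ (distribˡ σ _ _) ⟩
        fromℕ b + (σ * fromℕ b + σ * fromℕ k)         ≈⟨ +-assoc _ _ _ ⟨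
        fromℕ b + σ * fromℕ b + σ * fromℕ k           ≈⟨ +-congʳ (x+σx≈0 (fromℕ b)) ⟩
        0# + σ * fromℕ k                              ≈⟨ +-identityˡ _ ⟩
        σ * fromℕ k                                   ∎
      y-below : ∀ k → k ≤ b → y (b ∸ k) ≈ fromℕ k
      y-below k k≤b = begin
        fromℕ b + σ * fromℕ (b ∸ k)                        ≡⟨ ≡.cong (λ N → fromℕ N + σ * fromℕ (b ∸ k)) (ℕ.m+[n∸m]≡n k≤b) ⟨
        fromℕ (k ℕ.+ (b ∸ k)) + σ * fromℕ (b ∸ k)          ≈⟨ +-congʳ (fromℕ-+ k (b ∸ k)) ⟩
        fromℕ k + fromℕ (b ∸ k) + σ * fromℕ (b ∸ k)        ≈⟨ +-assoc _ _ _ ⟩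
        fromℕ k + (fromℕ (b ∸ k) + σ * fromℕ (b ∸ k))      ≈⟨ +-congˡ (x+σx≈0 _) ⟩
        fromℕ k + 0#                                       ≈⟨ +-identityʳ _ ⟩
        fromℕ k                                            ∎
      lower≈ : ∀ k → k < b → t (b ∸ suc k) ≈ lower k
      lower≈ k k<b = *-congˡ (*-cong (y-below (suc k) k<b) (eval-cong (E j) (y-below (suc k) k<b)))
      middle≈ : t (b ℕ.+ 0) ≈ 0#
      middle≈ = trans (*-congˡ (trans (*-congʳ (trans (y-above 0) (zeroʳ σ))) (zeroˡ _))) (zeroʳ _)
      upper≈ : ∀ k → t (b ℕ.+ suc k) ≈ upper k
      upper≈ k = *-congˡ (*-cong (y-above (suc k))
        (eval-cong (E j) (trans (y-above (suc k)) (-1*x≈-x _))))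

    -- Summation over the family, and the two parities of n.

    module _ (v : ℕ → Carrier) (deg : ∀ j → j ≤ n → DegreeAtMost j (E j))
             (lead : ∀ j → j ≤ n → fromℕ (j !) * coeff (E j) j ≈ v j) where

      alternatingSum : Carrier
      alternatingSum = ∑[ j < suc n ] ([-1]^ j) * (fromℕ (suc j) * v j)

      c≈±alternatingSum : c n v ≈ ([-1]^ n) * alternatingSum
      c≈±alternatingSum = trans (∑-cong (suc n) pointwise) (sym (*-∑ (suc n) ([-1]^ n) (λ p → ([-1]^ p) * (fromℕ (suc p) * v p))))
        where
        pointwise : ∀ p → p < suc n →
          ([-1]^ (n ∸ p)) * fromℕ (suc p) * v p ≈ ([-1]^ n) * (([-1]^ p) * (fromℕ (suc p) * v p))
        pointwise p (s≤s p≤n) = trans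
          (*-congʳ (*-congʳ (trans ([-1]^-∸ p≤n) ([-1]^-+ n p))))
          (trans (*-congʳ (*-assoc _ _ _)) (trans (*-assoc _ _ _) (*-congˡ (*-assoc _ _ _))))

      σ*∑[above+below] : ∀ {a b} → a ℕ.+ b ≡ suc n →
        σ * (∑< (suc n) (above b) + ∑< (suc n) (below a)) ≈ alternatingSum
      σ*∑[above+below] {a} {b} a+b≡1+n = begin
        σ * (∑< (suc n) (above b) + ∑< (suc n) (below a))
          ≈⟨ *-congˡ (∑-+ (suc n) (above b) (below a)) ⟨
        σ * (∑[ j < suc n ] (above b j + below a j))
          ≈⟨ *-∑ (suc n) σ (λ j → above b j + below a j) ⟩
        (∑[ j < suc n ] σ * (above b j + below a j))
          ≈⟨ ∑-cong (suc n) pointwise ⟩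
        alternatingSum ∎
        where
        pointwise : ∀ j → j < suc n →
          σ * (above b j + below a j) ≈ ([-1]^ j) * (fromℕ (suc j) * v j)
        pointwise j (s≤s j≤n) = trans (σ*[above+below] a+b≡1+n j≤n (deg j j≤n)) (*-congˡ (begin
          fromℕ (suc j !) * coeff (E j) j              ≈⟨ *-congʳ (fromℕ-* (suc j) (j !)) ⟩
          fromℕ (suc j) * fromℕ (j !) * coeff (E j) j  ≈⟨ *-assoc _ _ _ ⟩
          fromℕ (suc j) * (fromℕ (j !) * coeff (E j) j) ≈⟨ *-congˡ (lead j j≤n) ⟩
          fromℕ (suc j) * v j                          ∎))

      -- The difference identity pairs `above b` with `below a`, whereas `grid a` contains `above a`
      -- and `below a`. Adding `grid b` makes the sum symmetric, and it regroups into the pairs (a,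
      -- b) and (b, a).
      σ*[grid+grid] : ∀ {a b} → a ℕ.+ b ≡ suc n → σ * (grid a + grid b) ≈ alternatingSum + alternatingSum
      σ*[grid+grid] {a} {b} a+b≡1+n = begin
        σ * (grid a + grid b)
          ≈⟨ *-congˡ (+-cong (grid-split a) (grid-split b)) ⟩
        σ * ((A a + B a) + (A b + B b))
          ≈⟨ solve 5 (λ s x y z w → s :* ((x :+ y) :+ (z :+ w)) := s :* (z :+ y) :+ s :* (x :+ w)) refl
               σ (A a) (B a) (A b) (B b) ⟩
        σ * (A b + B a) + σ * (A a + B b)
          ≈⟨ +-cong (σ*∑[above+below] a+b≡1+n) (σ*∑[above+below] (≡.trans (ℕ.+-comm b a) a+b≡1+n)) ⟩
        alternatingSum + alternatingSum ∎
        where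
        A B : ℕ → Carrier
        A a = ∑< (suc n) (above a)
        B a = ∑< (suc n) (below a)

      module _ (half : Carrier) (half+half≈1 : half + half ≈ 1#) where

        half*[x+x]≈x : ∀ x → half * (x + x) ≈ x
        half*[x+x]≈x x = begin
          half * (x + x)       ≈⟨ solve 2 (λ h x → h :* (x :+ x) := (h :+ h) :* x) refl half x ⟩
          (half + half) * x    ≈⟨ *-congʳ half+half≈1 ⟩
          1# * x               ≈⟨ *-identityˡ x ⟩
          x                    ∎

        -- With a = b = m the symmetric identity is twice the desired one and is halved. The
        -- remaining `σ` cancels against (-1)^n.
        c-odd : ∀ m → m ℕ.+ m ≡ suc n →
          c n v ≈ ∑-range m n (λ p → ∑-range 1 (p ℕ.+ 1 ∸ m) (λ i →
            ([-1]^ (p ℕ.+ m ∸ i)) * fromℕ ((p ℕ.+ 1) C (m ℕ.+ i)) * fromℕ i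
              * (eval (E p) (- fromℕ i) + F n E p (fromℕ i))))
        -- The case m = 0 contradicts 2m = n + 1; for m > 0 the predecessor `m-1` gives the bound i
        -- ≤ p in `same`.
        c-odd zero    ()
        c-odd m@(suc m-1) m+m≡1+n = begin
          c n v                          ≈⟨ c≈±alternatingSum ⟩
          ([-1]^ n) * alternatingSum                  ≈⟨ *-cong [-1]^n≈σ (half*[x+x]≈x alternatingSum) ⟨
          σ * (half * (alternatingSum + alternatingSum))           ≈⟨ *-congˡ (*-congˡ (σ*[grid+grid] m+m≡1+n)) ⟨
          σ * (half * (σ * (grid m + grid m)))
            ≈⟨ solve 3 (λ s h g → s :* (h :* (s :* g)) := s :* (s :* (h :* g))) refl σ half _ ⟩
          σ * (σ * (half * (grid m + grid m)))  ≈⟨ σσx≈x _ ⟩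
          half * (grid m + grid m)       ≈⟨ half*[x+x]≈x _ ⟩
          grid m                         ≈⟨ ∑∑-rectangular n m w (weight m) e m≤1+n same (λ p i → weight-zero m) ⟨
          _                              ∎
          where
          e w : ℕ → ℕ → Carrier
          e p i = eval (E p) (- fromℕ i) + F n E p (fromℕ i)
          w p i = ([-1]^ (p ℕ.+ m ∸ i)) * fromℕ ((p ℕ.+ 1) C (m ℕ.+ i)) * fromℕ i
          m≤1+n : m ≤ suc n
          m≤1+n = ≡.subst (m ≤_) m+m≡1+n (ℕ.m≤m+n m m)
          [-1]^n≈σ : σ ≈ [-1]^ n
          [-1]^n≈σ = begin
            σ                  ≈⟨ *-identityʳ σ ⟨
            σ * 1#             ≈⟨ *-congˡ (trans ([-1]^-+ m m) ([-1]^-square m)) ⟨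
            σ * [-1]^ (m ℕ.+ m)  ≡⟨ ≡.cong (λ N → σ * [-1]^ N) m+m≡1+n ⟩
            σ * (σ * [-1]^ n)  ≈⟨ σσx≈x _ ⟩
            [-1]^ n            ∎
          same : ∀ p i → m ℕ.+ suc i ≤ suc p → w p (suc i) ≈ weight m p (suc i)
          same p i (s≤s le) = *-congʳ (*-cong
            ([-1]^-∸ (ℕ.≤-trans (ℕ.m+n≤o⇒n≤o m-1 le) (ℕ.m≤m+n p m)))
            (reflexive (≡.cong (λ N → fromℕ (N C (m ℕ.+ suc i))) (ℕ.+-comm p 1))))

        -- Here (-1)^n = 1, and the grids for m and m + 1 are averaged. Their weights have opposite
        -- signs, which produces the difference of binomials; the factor `σ` accounts for the extra
        -- 1 in the exponent.
        c-even : (_⊖_ : Carrier → Carrier → Carrier) → (∀ x y → x ⊖ y ≈ x + - y) →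
          ∀ m → m ℕ.+ m ≡ n →
          c n v ≈ ∑-range m n (λ p → ∑-range 1 (p ℕ.+ 1 ∸ m) (λ i →
            ([-1]^ (p ℕ.+ 1 ℕ.+ m ∸ i))
              * (fromℕ ((p ℕ.+ 1) C (m ℕ.+ i)) ⊖ fromℕ ((p ℕ.+ 1) C (m ℕ.+ i ℕ.+ 1)))
              * (fromℕ i * half)
              * (eval (E p) (- fromℕ i) + F n E p (fromℕ i))))
        c-even _⊖_ ⊖≈- m m+m≡n = begin
          c n v                               ≈⟨ c≈±alternatingSum ⟩
          ([-1]^ n) * alternatingSum                       ≡⟨ ≡.cong (λ N → [-1]^ N * alternatingSum) m+m≡n ⟨
          [-1]^ (m ℕ.+ m) * alternatingSum                 ≈⟨ *-congʳ (trans ([-1]^-+ m m) ([-1]^-square m)) ⟩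
          1# * alternatingSum                              ≈⟨ *-identityˡ alternatingSum ⟩
          alternatingSum                                   ≈⟨ half*[x+x]≈x alternatingSum ⟨
          half * (alternatingSum + alternatingSum)                      ≈⟨ *-congˡ (σ*[grid+grid] m+[1+m]≡1+n) ⟨
          half * (σ * (grid m + grid (suc m))) ≈⟨ *-assoc _ _ _ ⟨
          half * σ * (grid m + grid (suc m))
            ≈⟨ ∑∑-linear (suc n) (half * σ) (λ p k → weight m p (suc k))
                 (λ p k → weight (suc m) p (suc k)) (λ p k → e p (suc k)) ⟨
          (∑[ p < suc n ] ∑[ k < suc n ] w p (suc k) * e p (suc k))
            ≈⟨ ∑∑-rectangular n m w₀ w e m≤1+n same w≈0 ⟨
          _                                   ∎
          where
          m+[1+m]≡1+n : m ℕ.+ suc m ≡ suc n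
          m+[1+m]≡1+n = ≡.trans (ℕ.+-suc m m) (≡.cong suc m+m≡n)
          m≤1+n : m ≤ suc n
          m≤1+n = ≡.subst (m ≤_) m+[1+m]≡1+n (ℕ.m≤m+n m (suc m))
          e w₀ w : ℕ → ℕ → Carrier
          e p i = eval (E p) (- fromℕ i) + F n E p (fromℕ i)
          w₀ p i = ([-1]^ (p ℕ.+ 1 ℕ.+ m ∸ i))
            * (fromℕ ((p ℕ.+ 1) C (m ℕ.+ i)) ⊖ fromℕ ((p ℕ.+ 1) C (m ℕ.+ i ℕ.+ 1)))
            * (fromℕ i * half)
          w p i = half * σ * (weight m p i + weight (suc m) p i)
          w≈0 : ∀ p i → suc p < m ℕ.+ i → w p i ≈ 0#
          w≈0 p i lt = trans
            (*-congˡ (trans (+-cong (weight-zero m lt) (weight-zero (suc m) (ℕ.m<n⇒m<1+n lt))) (+-identityʳ 0#)))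
            (zeroʳ _)
          same : ∀ p i → m ℕ.+ suc i ≤ suc p → w₀ p (suc i) ≈ w p (suc i)
          same p i le = begin
            w₀ p (suc i)
              ≡⟨ ≡.cong₂ (λ P Q → ([-1]^ (P ℕ.+ m ∸ suc i)) * (fromℕ (P C (m ℕ.+ suc i)) ⊖ fromℕ (P C Q)) * (x * half))
                   (ℕ.+-comm p 1) (ℕ.+-comm (m ℕ.+ suc i) 1) ⟩
            ([-1]^ (suc p ℕ.+ m ∸ suc i)) * (y ⊖ z) * (x * half)
              ≈⟨ *-congʳ (*-cong ([-1]^-∸ (ℕ.≤-trans (ℕ.m+n≤o⇒n≤o m le) (ℕ.m≤m+n (suc p) m)))
                   (trans (⊖≈- y z) (+-congˡ (sym (-1*x≈-x z))))) ⟩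
            σ * q * (y + σ * z) * (x * half)
              ≈⟨ solve 6 (λ s q y z x h →
                   s :* q :* (y :+ s :* z) :* (x :* h) := h :* s :* (q :* y :* x :+ s :* q :* z :* x)) refl
                   σ q y z x half ⟩
            half * σ * (weight m p (suc i) + σ * q * z * x)
              ≡⟨ ≡.cong (λ N → half * σ * (weight m p (suc i) + [-1]^ (N ℕ.+ suc i) * z * x)) (ℕ.+-suc p m) ⟨
            w p (suc i) ∎
            where
            q = [-1]^ (p ℕ.+ m ℕ.+ suc i)
            x = fromℕ (suc i)
            y = fromℕ (suc p C (m ℕ.+ suc i))
            z = fromℕ (suc p C suc (m ℕ.+ suc i))

-- Parity of n and rational scalars.

private
  2[n/2]≡n : ∀ {n} → 2 ∣ n → n / 2 ℕ.+ n / 2 ≡ n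
  2[n/2]≡n {n} 2∣n = ≡.trans (≡.cong (n / 2 ℕ.+_) (≡.sym (ℕ.+-identityʳ (n / 2)))) (m*[n/m]≡n 2∣n)

  -- Turns the hypothesis that 2 does not divide n into divisibility of n + 1, which makes the
  -- quotient (n + 1) / 2 exact.
  parity : ∀ n → 2 ∣ n ⊎ 2 ∣ suc n
  parity zero = inj₁ (2 ∣0)
  parity (suc n) with parity n
  ... | inj₁ 2∣n   = inj₂ (∣m∣n⇒∣m+n ∣-refl 2∣n)
  ... | inj₂ 2∣1+n = inj₁ 2∣1+n

  1/d+k/d≃[1+k]/d : ∀ k d → mkℚᵘ (+ 1) d ℚᵘ.+ mkℚᵘ (+ k) d ℚᵘ.≃ mkℚᵘ (+ suc k) d
  1/d+k/d≃[1+k]/d k d = ℚᵘ.*≡* (identity (+ k) (+ suc d))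
    where
    identity : ∀ x D → ((+ 1) ℤ.* D ℤ.+ x ℤ.* D) ℤ.* D ≡ ((+ 1) ℤ.+ x) ℤ.* (D ℤ.* D)
    identity = solve-∀

  -- Addition of reduced fractions divides by a gcd; passing to unreduced fractions leaves an
  -- identity of integers.
  k×1/d≡k/d : ∀ k d → k ·ℚ ((+ 1) ℚ./ suc d) ≡ (+ k) ℚ./ suc d
  k×1/d≡k/d zero    d = ≡.sym (ℚ.fromℚᵘ-cong {mkℚᵘ (+ 0) d} {ℚᵘ.0ℚᵘ} (ℚᵘ.*≡* ≡.refl))
  k×1/d≡k/d (suc k) d = ≡.trans (≡.cong (((+ 1) ℚ./ suc d) ℚ.+_) (k×1/d≡k/d k d))
    (ℚ.toℚᵘ-injective (begin
      ℚ.toℚᵘ (fromℚᵘ 1/D ℚ.+ fromℚᵘ k/D)               ≈⟨ ℚ.toℚᵘ-homo-+ (fromℚᵘ 1/D) (fromℚᵘ k/D) ⟩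
      ℚ.toℚᵘ (fromℚᵘ 1/D) ℚᵘ.+ ℚ.toℚᵘ (fromℚᵘ k/D)     ≈⟨ ℚᵘ.+-cong (ℚ.toℚᵘ-fromℚᵘ 1/D) (ℚ.toℚᵘ-fromℚᵘ k/D) ⟩
      1/D ℚᵘ.+ k/D                                     ≈⟨ 1/d+k/d≃[1+k]/d k d ⟩
      mkℚᵘ (+ suc k) d                                 ≈⟨ ℚ.toℚᵘ-fromℚᵘ (mkℚᵘ (+ suc k) d) ⟨
      ℚ.toℚᵘ (fromℚᵘ (mkℚᵘ (+ suc k) d))               ∎))
    where
    open import Relation.Binary.Reasoning.Setoid ℚᵘ.≃-setoid
    1/D = mkℚᵘ (+ 1) d
    k/D = mkℚᵘ (+ k) d

  d×1/d≡1 : ∀ d .{{_ : ℕ.NonZero d}} → d ·ℚ ((+ 1) ℚ./ d) ≡ ℚ.1ℚ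
  d×1/d≡1 (suc d) = ≡.trans (k×1/d≡k/d (suc d) d)
    (ℚ.fromℚᵘ-cong {mkℚᵘ (+ suc d) d} {ℚᵘ.1ℚᵘ} (ℚᵘ.*≡* (ℤ.*-comm (+ suc d) (+ 1))))

-- Additivity makes d · φ(1/d) the value of φ at a d-fold sum of 1/d, that is φ(1) = 1. In this way
-- j! and 2 become invertible in K.
record IsRationalEmbedding {κ ℓ} (K : CommutativeRing κ ℓ) (φ : ℚ → CommutativeRing.Carrier K) : Set ℓ where
  open CommutativeRing K
  field
    φ-0 : φ ℚ.0ℚ ≈ 0#
    φ-1 : φ ℚ.1ℚ ≈ 1#
    φ-+ : ∀ p q → φ p + φ q ≈ φ (p ℚ.+ q)

module RationalScalars {κ ℓ} (K : CommutativeRing κ ℓ) {φ : ℚ → CommutativeRing.Carrier K}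
  (isEmbedding : IsRationalEmbedding K φ) where

  open CommutativeRing K
  open IsRationalEmbedding isEmbedding
  open PolynomialFamily K

  fromℕ*φ : ∀ k q → fromℕ k * φ q ≈ φ (k ·ℚ q)
  fromℕ*φ zero    q = trans (zeroˡ (φ q)) (sym φ-0)
  fromℕ*φ (suc k) q = trans (distribʳ (φ q) 1# (fromℕ k))
    (trans (+-cong (*-identityˡ (φ q)) (fromℕ*φ k q)) (φ-+ q (k ·ℚ q)))

  d*φ[1/d]≈1 : ∀ d .{{_ : ℕ.NonZero d}} → fromℕ d * φ ((+ 1) ℚ./ d) ≈ 1#
  d*φ[1/d]≈1 d = trans (fromℕ*φ d ((+ 1) ℚ./ d)) (trans (reflexive (≡.cong φ (d×1/d≡1 d))) φ-1)

  φ½+φ½≈1 : φ ℚ.½ + φ ℚ.½ ≈ 1#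
  φ½+φ½≈1 = trans (φ-+ ℚ.½ ℚ.½) φ-1

-- Over ℂ, two applications of an operation that are not syntactically equal are
-- compared by unfolding the proofs that sequences are Cauchy, which does not
-- finish in reasonable time.  The operations are therefore variables that equal
-- those of K, so that substituting for them gives exactly the terms of the theorem.
module _ {κ ℓ} (K : CommutativeRing κ ℓ) where

  private
    module K = CommutativeRing K
    module P = PolynomialFamily K

  open K using (Carrier; _≈_)

  theorem-over : {_+_ _*_ _-_ : Carrier → Carrier → Carrier} { -_ : Carrier → Carrier}
    {fromℕ [-1]^_ : ℕ → Carrier} {∑ : ℕ → ℕ → (ℕ → Carrier) → Carrier}
    {eval : P.Polynomial → Carrier → Carrier}
    {c : ℕ → (ℕ → Carrier) → Carrier} {F : ℕ → (ℕ → P.Polynomial) → ℕ → Carrier → Carrier}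
    {φ : ℚ → Carrier} {½ : Carrier} {1/_! : ℕ → Carrier} →
    _+_ ≡ CommutativeRing._+_ K → _*_ ≡ CommutativeRing._*_ K →
    -_ ≡ CommutativeRing.-_ K → (∀ x y → (x - y) ≈ (x + (- y))) →
    fromℕ ≡ PolynomialFamily.fromℕ K → [-1]^_ ≡ PolynomialFamily.[-1]^_ K →
    ∑ ≡ PolynomialFamily.∑-range K → eval ≡ PolynomialFamily.eval K →
    c ≡ PolynomialFamily.c K → F ≡ PolynomialFamily.F K →
    IsRationalEmbedding K φ → ½ ≡ φ ℚ.½ → (∀ j → 1/ j ! ≡ φ (((+ 1) ℚ./ (j !)) {{j ℕ.!≢0}})) →
    (n : ℕ) (E : ℕ → P.Polynomial) (v : ℕ → Carrier) →
    (∀ j → j ≤ n → P.DegreeAtMost j (E j)) →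
    (∀ j → j ≤ n → P.coeff (E j) j ≈ ((1/ j !) * v j)) →
    (¬ (2 ∣ n) →
      let m = (n ℕ.+ 1) / 2 in
      c n v ≈
        ∑ m n (λ p → ∑ 1 ((p ℕ.+ 1) ∸ m) (λ i →
          ((([-1]^ ((p ℕ.+ m) ∸ i))
            * fromℕ ((p ℕ.+ 1) C (m ℕ.+ i)))
            * fromℕ i)
            * (eval (E p) (- fromℕ i) + F n E p (fromℕ i)))))
    ×
    (2 ∣ n →
      let m = n / 2 in
      c n v ≈
        ∑ m n (λ p → ∑ 1 ((p ℕ.+ 1) ∸ m) (λ i →
          ((([-1]^ ((p ℕ.+ 1 ℕ.+ m) ∸ i))
            * (fromℕ ((p ℕ.+ 1) C (m ℕ.+ i)) - fromℕ ((p ℕ.+ 1) C (m ℕ.+ i ℕ.+ 1))))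
            * (fromℕ i * ½))
            * (eval (E p) (- fromℕ i) + F n E p (fromℕ i)))))
  theorem-over {_-_ = _⊖_} {½ = ½} ≡.refl ≡.refl ≡.refl ⊖≈- ≡.refl ≡.refl ≡.refl ≡.refl ≡.refl ≡.refl
    isEmbedding ≡.refl 1/j!≡ n E v deg lead = odd , even
    where
    open CombinatorialSums K
    open RationalScalars K isEmbedding
    -- The hypothesis gives the coefficient as v_j / j!; multiplying by j! yields the division-free
    -- form used above.
    j!*coeff≈v : ∀ j → j ≤ n → P.fromℕ (j !) K.* P.coeff (E j) j ≈ v j
    j!*coeff≈v j j≤n = K.trans (K.*-congˡ (K.trans (lead j j≤n) (K.*-congʳ (K.reflexive (1/j!≡ j)))))
      (K.trans (K.sym (K.*-assoc _ _ _))
      (K.trans (K.*-congʳ (d*φ[1/d]≈1 (j !) {{j ℕ.!≢0}})) (K.*-identityˡ (v j))))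
    odd = λ 2∤n → c-odd n E v deg j!*coeff≈v ½ φ½+φ½≈1 ((n ℕ.+ 1) / 2)
      (≡.trans (2[n/2]≡n (≡.subst (2 ∣_) (ℕ.+-comm 1 n) ([ (λ 2∣n → contradiction 2∣n 2∤n) , id ]′ (parity n))))
        (ℕ.+-comm n 1))
    even = λ 2∣n → c-even n E v deg j!*coeff≈v ½ φ½+φ½≈1 _⊖_ ⊖≈- (n / 2) (2[n/2]≡n 2∣n)

-- Specialisation to the complex numbers.

open import Defs

private
  fromℚ-isRationalEmbedding : IsRationalEmbedding ℂ-commutativeRing fromℚ
  fromℚ-isRationalEmbedding = record
    { φ-0 = CommutativeRing.refl ℂ-commutativeRing
    ; φ-1 = CommutativeRing.refl ℂ-commutativeRing
    -- Both parts are constant sequences of rationals that agree termwise; the imaginary one is 0 +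
    -- 0 = 0.
    ; φ-+ = λ p q → Real.≗⇒≈ (λ _ → ≡.refl) Complexification., Real.≗⇒≈ (λ _ → ≡.refl)
    }

  ℂ+≡ : _+_ ≡ CommutativeRing._+_ ℂ-commutativeRing
  ℂ+≡ = ≡.refl
  ℂ*≡ : _*_ ≡ CommutativeRing._*_ ℂ-commutativeRing
  ℂ*≡ = ≡.refl
  ℂneg≡ : -_ ≡ CommutativeRing.-_ ℂ-commutativeRing
  ℂneg≡ = ≡.refl
  fromℕ≡ : fromℕ ≡ PolynomialFamily.fromℕ ℂ-commutativeRing
  fromℕ≡ = ≡.refl
  [-1]^≡ : [-1]^_ ≡ PolynomialFamily.[-1]^_ ℂ-commutativeRing
  [-1]^≡ = ≡.refl
  ∑≡ : ∑-range ≡ PolynomialFamily.∑-range ℂ-commutativeRing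
  ∑≡ = ≡.refl
  eval≡ : eval ≡ PolynomialFamily.eval ℂ-commutativeRing
  eval≡ = ≡.refl
  c≡ : c ≡ PolynomialFamily.c ℂ-commutativeRing
  c≡ = ≡.refl
  F≡ : F ≡ PolynomialFamily.F ℂ-commutativeRing
  F≡ = ≡.refl

  x-y≈x+[-y] : ∀ x y → x - y ≈ x + (- y)
  x-y≈x+[-y] x y = Real.≗⇒≈ (λ _ → ≡.refl) Complexification., Real.≗⇒≈ (λ _ → ≡.refl)

  ½≡ : ½ ≡ fromℚ ℚ.½
  ½≡ = ≡.refl
  1/!≡ : ∀ j → 1/ j ! ≡ fromℚ (((+ 1) ℚ./ (j !)) {{j ℕ.!≢0}})
  1/!≡ _ = ≡.refl

  -- No type is given: the operations must be inferred from the equations, before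
  -- the result is compared with the statement.
  theoremℂ = theorem-over ℂ-commutativeRing
    ℂ+≡ ℂ*≡ ℂneg≡ x-y≈x+[-y] fromℕ≡ [-1]^≡ ∑≡ eval≡ c≡ F≡ fromℚ-isRationalEmbedding ½≡ 1/!≡

theorem2p2 : (n : ℕ) (E : ℕ → Polynomial) (v : ℕ → ℂ) →
    (∀ j → j ≤ n → DegreeAtMost j (E j)) →
    (∀ j → j ≤ n → coeff (E j) j ≈ (1/ j !) * v j) →
    (¬ (2 ∣ n) →
    let m = (n ℕ.+ 1) / 2 in
    c n v ≈
    (∑[ p from m to n ] ∑[ i from 1 to ((p ℕ.+ 1) ∸ m) ]
    ([-1]^ ((p ℕ.+ m) ∸ i))
    * fromℕ ((p ℕ.+ 1) C (m ℕ.+ i))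
    * fromℕ i
    * (eval (E p) (- fromℕ i) + F n E p (fromℕ i))))
    ×
    (2 ∣ n →
    let m = n / 2 in
    c n v ≈
    (∑[ p from m to n ] ∑[ i from 1 to ((p ℕ.+ 1) ∸ m) ]
    ([-1]^ ((p ℕ.+ 1 ℕ.+ m) ∸ i))
    * (fromℕ ((p ℕ.+ 1) C (m ℕ.+ i)) - fromℕ ((p ℕ.+ 1) C (m ℕ.+ i ℕ.+ 1)))
    * (fromℕ i * ½)
    * (eval (E p) (- fromℕ i) + F n E p (fromℕ i))))
theorem2p2 = theoremℂ
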